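{- For any $n \in \mathbb{N}$ with $n \geq 2$: 1. any regular expression defining $K_n$ is of size at least $2^{n}$; and 2. there is a DFA $A_n$ of size $\mathcal{O}(n^2\log n)$ defining $K_n$. (In item 2 the implicit constant is independent of $n$.)
   Context: $\mathbb{N}$ denotes the natural numbers without zero. Regular expressions over a finite alphabet $\Sigma$: $\emptyset$, $\varepsilon$, and every symbol $a\in\Sigma$ are regular expressions; if $r_1,r_2$ are regular expressions, then so are $r_1\cdot r_2$, $r_1+r_2$ and $r_1^*$. The language $L(r)$ is defined as usual; $r$ defines a language $L$ if $L(r)=L$. The size $|r|$ is the number of alphabet symbols and operators in $r$, disregarding parentheses: $|\emptyset|=|\varepsilon|=|a|=1$ for $a\in\Sigma$, $|r_1r_2|=|r_1+r_2|=|r_1|+|r_2|+1$, $|r^*|=|r|+1$. An NFA is a tuple $(Q,q_0,\delta,F)$ with state set $Q$, initial state $q_0$, set of final states $F$ and transition relation $\delta\subseteq Q\times\Sigma\times Q$; its size is $|Q|+|\delta|$. It is deterministic (a DFA) if for all $a\in\Sigma$, $q\in Q$ there is at most one $q'$ with $(q,a,q')\in\delta$ (so transitions may be missing). For $n\in\mathbb{N}$ let $\Sigma_n=\{a_{i,j}\mid 0\le i,j\le n-1\}$. The language $Z_n$ over $\Sigma_n$ contains exactly all strings of the form $a_{i_0,i_1}a_{i_1,i_2}\cdots a_{i_{k-1},i_k}$ with $k\in\mathbb{N}$ (so $k\geq 1$). Let $\Sigma_K=\{0,1,\$,\#\}$. For $0\le i<n$ let $\mathrm{enc}(i)$ be the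 $\lceil\log_2 n\rceil$-bit binary encoding of $i$. Define $\rho_n(a_{i,j})=\mathrm{enc}(j)\,\$\,\mathrm{enc}(i)\,\#$ (note the swap of indices), extended to strings by $\rho_n(a_{i_0,i_1}\cdots a_{i_{k-1},i_k})=\rho_n(a_{i_0,i_1})\cdots\rho_n(a_{i_{k-1},i_k})$. Then $K_n=\{\rho_n(w)\mid w\in Z_n\}$, a language over $\Sigma_K$. -}

module Defs where

open import Data.Fin.Base using (Fin; suc; toℕ; inject₁)
open import Data.Fin.Subset using (Subset) renaming (_∈_ to _∈ₛ_)
open import Data.List.Base using (List; []; _∷_; [_]; _++_; concat; concatMap; length; tabulate)
open import Data.List.Membership.Propositional using (_∈_)
open import Data.List.Relation.Unary.All using (All)
open import Data.List.Relation.Unary.Unique.Propositional using (Unique)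
open import Data.Nat.Base using (ℕ; zero; suc; _+_; _≤_; _/_; _%_)
open import Data.Nat.Logarithm using (⌈log₂_⌉)
open import Data.Product.Base using (∃-syntax; _×_; _,_)
open import Level using (0ℓ)
open import Relation.Binary.PropositionalEquality.Core using (_≡_)
open import Relation.Unary using (Pred; ∅; ｛_｝; _∪_)

Language : Set → Set₁
Language Σ = Pred (List Σ) 0ℓ

infixl 7 _·_
_·_ : {Σ : Set} → Language Σ → Language Σ → Language Σ
(L₁ · L₂) w = ∃[ u ] ∃[ v ] (L₁ u × L₂ v × w ≡ u ++ v)

infix 8 _*
_* : {Σ : Set} → Language Σ → Language Σ
(L *) w = ∃[ us ] (All L us × w ≡ concat us)

infixl 6 _⊕_
infixl 7 _⊙_
infix  8 _⋆

data RegExp (Σ : Set) : Set where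
  ∅ᵣ  : RegExp Σ
  εᵣ  : RegExp Σ
  sym : Σ → RegExp Σ
  _⊙_ : RegExp Σ → RegExp Σ → RegExp Σ
  _⊕_ : RegExp Σ → RegExp Σ → RegExp Σ
  _⋆  : RegExp Σ → RegExp Σ

L⟦_⟧ : {Σ : Set} → RegExp Σ → Language Σ
L⟦ ∅ᵣ ⟧      = ∅
L⟦ εᵣ ⟧      = ｛ [] ｝
L⟦ sym a ⟧   = ｛ [ a ] ｝
L⟦ r₁ ⊙ r₂ ⟧ = L⟦ r₁ ⟧ · L⟦ r₂ ⟧
L⟦ r₁ ⊕ r₂ ⟧ = L⟦ r₁ ⟧ ∪ L⟦ r₂ ⟧
L⟦ r ⋆ ⟧     = L⟦ r ⟧ *

sizeᵣ : {Σ : Set} → RegExp Σ → ℕ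
sizeᵣ ∅ᵣ        = 1
sizeᵣ εᵣ        = 1
sizeᵣ (sym _)   = 1
sizeᵣ (r₁ ⊙ r₂) = sizeᵣ r₁ + sizeᵣ r₂ + 1
sizeᵣ (r₁ ⊕ r₂) = sizeᵣ r₁ + sizeᵣ r₂ + 1
sizeᵣ (r ⋆)     = sizeᵣ r + 1

-- The transition relation is a finite set of triples, represented by a
-- duplicate-free list, so that its cardinality is the length of the list.
record NFA (Σ : Set) : Set where
  field
    ∣Q∣ : ℕ

  Q : Set
  Q = Fin ∣Q∣

  field
    q₀       : Q
    δ        : List (Q × Σ × Q)
    δ-unique : Unique δ
    F        : Subset ∣Q∣

  data Run : Q → List Σ → Q → Set where
    done : ∀ {q} → Run q [] q
    step : ∀ {q q′ q″ a w} → (q , a , q′) ∈ δ → Run q′ w q″ → Run q (a ∷ w) q″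

  L : Language Σ
  L w = ∃[ q ] (q ∈ₛ F × Run q₀ w q)

  size : ℕ
  size = ∣Q∣ + length δ

  -- At most one successor; transitions may be missing.
  Deterministic : Set
  Deterministic = ∀ {q a q′ q″} → (q , a , q′) ∈ δ → (q , a , q″) ∈ δ → q′ ≡ q″

data Σₙ (n : ℕ) : Set where
  a[_,_] : Fin n → Fin n → Σₙ n

Z : (n : ℕ) → Language (Σₙ n)
Z n w = ∃[ k ] ∃[ i ] (1 ≤ k × w ≡ word {k} i)
  where
  word : {k : ℕ} → (Fin (suc k) → Fin n) → List (Σₙ n)
  word i = tabulate (λ t → a[ i (inject₁ t) , i (suc t) ])

data ΣK : Set where
  𝟘 𝟙 $ ♯ : ΣK

-- The `b` lowest-order binary digits of a number, most significant first.
bits : (b : ℕ) → ℕ → List ΣK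
bits zero    _ = []
bits (suc b) m = bits b (m / 2) ++ [ digit (m % 2) ]
  where
  digit : ℕ → ΣK
  digit zero    = 𝟘
  digit (suc _) = 𝟙

enc : (n : ℕ) → Fin n → List ΣK
enc n i = bits ⌈log₂ n ⌉ (toℕ i)

ρ : (n : ℕ) → List (Σₙ n) → List ΣK
ρ n = concatMap ρ₁
  where
  ρ₁ : Σₙ n → List ΣK
  ρ₁ a[ i , j ] = enc n j ++ [ $ ] ++ enc n i ++ [ ♯ ]

K : ℕ → Language ΣK
K n w = ∃[ v ] (Z n v × w ≡ ρ n v)

{-# OPTIONS --safe #-}
module Submission where

open import Defs
open import Data.Nat.Base using (ℕ; _≤_; _*_; _^_)
open import Data.Nat.Logarithm using (⌈log₂_⌉)
open import Data.Product.Base using (Σ-syntax; _×_)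
open import Relation.Unary using (_≐_)

open import Data.Bool.Base using (Bool; true; false)
open import Data.Empty using (⊥-elim)
open import Data.Fin.Base using (Fin; zero; suc; toℕ; fromℕ<; inject₁; punchIn; combine; remQuot)
open import Data.Fin.Properties using (any?; toℕ-injective; toℕ<n; toℕ-fromℕ<; punchInᵢ≢i; punchIn-injective; remQuot-combine) renaming (_≟_ to _≟F_)
open import Data.List.Base using (List; []; _∷_; [_]; _++_; concat; replicate; tabulate; lookup; length; map; take; drop; foldl; allFin; cartesianProduct)
open import Data.List.Properties using (++-assoc; ++-identityʳ; ++-conicalˡ; ++-conicalʳ; ++-monoid; ∷-injective; ∷-injectiveˡ; ∷-injectiveʳ; ∷ʳ-injective; concat-++; foldl-++; length-++; length-map; length-tabulate; tabulate-lookup; take-all; drop-all; ≡-dec)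
open import Data.List.Membership.DecPropositional using () renaming (_∈?_ to member?)
open import Data.List.Membership.Propositional using (_∈_; _∉_)
open import Data.List.Membership.Propositional.Properties using (∈-++⁻; ∈-++⁺ˡ; ∈-++⁺ʳ; ∈-tabulate⁺; ∈-tabulate⁻; ∈-concat⁻′; ∈-map⁺; ∈-map⁻; ∈-cartesianProduct⁺; ∈-allFin)
open import Data.List.Relation.Unary.All using (All; []; _∷_) renaming (map to All-map)
open import Data.List.Relation.Unary.All.Properties using () renaming (++⁺ to All-++⁺)
open import Data.List.Relation.Unary.AllPairs using ([]; _∷_)
open import Data.List.Relation.Unary.Any using (here; there)
open import Data.List.Relation.Unary.Unique.Propositional using (Unique)
open import Data.List.Relation.Unary.Unique.Propositional.Properties using (map⁺; cartesianProduct⁺; allFin⁺)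
open import Data.Maybe.Base using (Maybe; just; nothing)
open import Data.Nat.Base using (zero; suc; _+_; _∸_; _<_; z≤n; s≤s; >-nonZero; _/_; _%_; ⌈_/2⌉; ⌊_/2⌋)
open import Data.Nat.DivMod using (m%n<n; m≡m%n+[m/n]*n; m<n*o⇒m/o<n)
open import Data.Nat.Induction using (<-rec)
open import Data.Nat.Logarithm using (⌈log₂⌉-mono-≤; ⌈log₂⌈n/2⌉⌉≡⌈log₂n⌉∸1)
open import Data.Nat.Properties using (≤-refl; ≤-trans; ≤-reflexive; <-≤-trans; <-irrefl; ≮⇒≥; _<?_; +-assoc; +-comm; +-identityʳ; +-suc; +-mono-≤; +-monoˡ-≤; +-monoʳ-≤; *-comm; *-mono-≤; *-monoʳ-≤; m≤m+n; m≤n+m; m≤n⇒∃[o]m+o≡n; m^n>0; ⌈n/2⌉<n; ⌊n/2⌋≤⌈n/2⌉; ⌊n/2⌋+⌈n/2⌉≡n; module ≤-Reasoning)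
open import Data.Nat.Tactic.RingSolver using (solve-∀)
open import Data.Product.Base using (∃-syntax; _,_; proj₁; proj₂; map₂)
open import Data.Sum.Base using (_⊎_; inj₁; inj₂)
open import Data.Unit.Base using (⊤; tt)
open import Data.Vec.Base using () renaming (tabulate to tabulateᵥ)
open import Data.Vec.Properties using (lookup⇒[]=; []=⇒lookup; lookup∘tabulate)
open import Function.Base using (_∘_; id)
open import Relation.Binary.Definitions using (DecidableEquality)
open import Relation.Binary.PropositionalEquality.Core using (_≡_; _≢_; refl; cong; cong₂; subst; trans) renaming (sym to ≡-sym)
open import Relation.Nullary using (Dec; yes; no; _×-dec_)
open import Relation.Unary using (_⊆_)
open import Tactic.MonoidSolver using (solve)

-- Lower bound (after Ehrenfeucht and Zeiger).  Call r normal if its words are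
-- factors of words of K n.  For a set S of vertices let `cycle S` be a sequence of
-- vertices containing, for every p in S, a long power of `cycle (S - p)`.  By
-- induction on |S|, a normal r covering the code of `cycle S` has at least 2 ^ |S|
-- letters.  Because of the swapped indices, every point at which words of a
-- starred subexpression t ⋆ of r may be inserted lies at one and the same vertex v.
-- A star covering the code of `cycle (S - p)` has 2 ^ (|S| - 1) letters by
-- induction.  The code of a power of `cycle (S - v)` offers no place for an
-- insertion, so either it is covered by r with t ⋆ replaced by ε, which gives
-- another 2 ^ (|S| - 1) letters, or it is covered by t alone, and one continues
-- with a star inside t.
--
-- Upper bound.  The automaton reads block by block; it remembers a representative
-- of the blocks with the prefix read so far.

-- Words, infixes, alphabetic width and contexts of regular expressions.

module _ {A : Set} where

  -- Levi's lemma: of two factorizations of one word, one cut lies at or beyond the other.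
  ++-split : (xs : List A) {ys : List A} (us : List A) {vs : List A} → xs ++ ys ≡ us ++ vs →
             (∃[ ws ] (xs ≡ us ++ ws × vs ≡ ws ++ ys)) ⊎ (∃[ ws ] (us ≡ xs ++ ws × ys ≡ ws ++ vs))
  ++-split xs       []       eq = inj₁ (xs , refl , ≡-sym eq)
  ++-split []       (u ∷ us) eq = inj₂ (u ∷ us , refl , eq)
  ++-split (x ∷ xs) (u ∷ us) eq with ∷-injective eq
  ... | refl , eq′ with ++-split xs us eq′
  ...   | inj₁ (ws , refl , q) = inj₁ (ws , refl , q)
  ...   | inj₂ (ws , refl , q) = inj₂ (ws , refl , q)

  []-or-≢[] : (xs : List A) → xs ≡ [] ⊎ xs ≢ []
  []-or-≢[] []      = inj₁ refl
  []-or-≢[] (_ ∷ _) = inj₂ λ ()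

  ≢[]-++ˡ : {xs ys : List A} → xs ≢ [] → xs ++ ys ≢ []
  ≢[]-++ˡ {xs} {ys} ne eq = ne (++-conicalˡ xs ys eq)

  ≢[]-++ʳ : {xs ys : List A} → ys ≢ [] → xs ++ ys ≢ []
  ≢[]-++ʳ {xs} {ys} ne eq = ne (++-conicalʳ xs ys eq)

  *-++ : {L : Language A} {u v : List A} → (L *) u → (L *) v → (L *) (u ++ v)
  *-++ (us , pus , refl) (vs , pvs , refl) = us ++ vs , All-++⁺ pus pvs , concat-++ us vs

  *-∷ : {L : Language A} {u v : List A} → L u → (L *) v → (L *) (u ++ v)
  *-∷ pu (vs , pvs , refl) = _ ∷ vs , pu ∷ pvs , refl

  *-embed : {L : Language A} {u : List A} → L u → (L *) u
  *-embed {L} {u} pu = subst (L *) (++-identityʳ u) (*-∷ pu ([] , [] , refl))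

  ++-assoc₁ : ∀ (u α m β v : List A) → u ++ (α ++ m ++ β) ++ v ≡ (u ++ α) ++ m ++ β ++ v
  ++-assoc₁ u α m β v = solve (++-monoid A)

  ++-assoc₂ : ∀ (u α m z n β v : List A) →
              u ++ ((α ++ m) ++ z ++ (n ++ β)) ++ v ≡ ((u ++ α) ++ m) ++ z ++ (n ++ β ++ v)
  ++-assoc₂ u α m z n β v = solve (++-monoid A)

  ++-assoc₃ : ∀ (α m β y : List A) → α ++ m ++ β ++ y ≡ (α ++ m ++ β) ++ y
  ++-assoc₃ α m β y = solve (++-monoid A)

  ++-assoc₄ : ∀ (α m n β : List A) → α ++ (m ++ n) ++ β ≡ (α ++ m ++ []) ++ n ++ β
  ++-assoc₄ α m n β = solve (++-monoid A)

  ++-assoc₅ : ∀ (α m n β : List A) → α ++ (m ++ n) ++ β ≡ (α ++ m) ++ n ++ β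
  ++-assoc₅ α m n β = solve (++-monoid A)

  ++-assoc₆ : ∀ (α z m n β : List A) → α ++ z ++ (m ++ n) ++ β ≡ (α ++ z ++ m ++ []) ++ n ++ β
  ++-assoc₆ α z m n β = solve (++-monoid A)

  ++-assoc₇ : ∀ (α m n γ : List A) → (α ++ (m ++ n)) ++ γ ≡ (α ++ m) ++ n ++ γ
  ++-assoc₇ α m n γ = solve (++-monoid A)

  infix 4 _Infix-of_
  _Infix-of_ : List A → List A → Set
  x Infix-of w = ∃[ u ] ∃[ v ] w ≡ u ++ x ++ v

  InfixClosure : Language A → Language A
  InfixClosure L x = ∃[ u ] ∃[ v ] L (u ++ x ++ v)

  Covers : RegExp A → List A → Set
  Covers r x = InfixClosure L⟦ r ⟧ x

  InfixClosure-infix : {L : Language A} {x y : List A} → x Infix-of y → InfixClosure L y → InfixClosure L x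
  InfixClosure-infix {L} {x} (u , v , refl) (u′ , v′ , p) =
    u′ ++ u , v ++ v′ , subst L (++-assoc₁ u′ u x v v′) p

  -- The lower bound is proved for the number of letters rather than for `sizeᵣ`: as `εᵣ` has no
  -- letters, replacing `t ⋆` by `εᵣ` loses exactly `width t`, and the contributions of the two
  -- parts add up.
  width : RegExp A → ℕ
  width ∅ᵣ        = 0
  width εᵣ        = 0
  width (sym _)   = 1
  width (r₁ ⊙ r₂) = width r₁ + width r₂
  width (r₁ ⊕ r₂) = width r₁ + width r₂
  width (r ⋆)     = width r

  data Context : Set where
    □    : Context
    _⊙ˡ_ : Context → RegExp A → Context
    _⊙ʳ_ : Context → RegExp A → Context
    _⊕ˡ_ : Context → RegExp A → Context
    _⊕ʳ_ : Context → RegExp A → Context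
    _⋆   : Context → Context

  -- Contexts are zippers: the outermost constructor is the innermost operator.
  plug : Context → RegExp A → RegExp A
  plug □        r = r
  plug (C ⊙ˡ s) r = plug C (r ⊙ s)
  plug (C ⊙ʳ s) r = plug C (s ⊙ r)
  plug (C ⊕ˡ s) r = plug C (r ⊕ s)
  plug (C ⊕ʳ s) r = plug C (s ⊕ r)
  plug (C ⋆)    r = plug C (r ⋆)

  sizeᵣ-plug : (C : Context) {r r′ : RegExp A} → sizeᵣ r′ ≤ sizeᵣ r → sizeᵣ (plug C r′) ≤ sizeᵣ (plug C r)
  sizeᵣ-plug □        le = le
  sizeᵣ-plug (C ⊙ˡ s) le = sizeᵣ-plug C (+-monoˡ-≤ 1 (+-monoˡ-≤ (sizeᵣ s) le))
  sizeᵣ-plug (C ⊙ʳ s) le = sizeᵣ-plug C (+-monoˡ-≤ 1 (+-monoʳ-≤ (sizeᵣ s) le))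
  sizeᵣ-plug (C ⊕ˡ s) le = sizeᵣ-plug C (+-monoˡ-≤ 1 (+-monoˡ-≤ (sizeᵣ s) le))
  sizeᵣ-plug (C ⊕ʳ s) le = sizeᵣ-plug C (+-monoˡ-≤ 1 (+-monoʳ-≤ (sizeᵣ s) le))
  sizeᵣ-plug (C ⋆)    le = sizeᵣ-plug C (+-monoˡ-≤ 1 le)

  width-plug : (C : Context) {r r′ : RegExp A} {d : ℕ} → width r ≡ d + width r′ →
               width (plug C r) ≡ d + width (plug C r′)
  width-plug C {r} {r′} {d} eq = go C r r′ eq
    where
    left : ∀ r r′ (s : RegExp A) → width r ≡ d + width r′ → width r + width s ≡ d + (width r′ + width s)
    left r r′ s eq = trans (cong (_+ width s) eq) (+-assoc d (width r′) (width s))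
    right : ∀ r r′ (s : RegExp A) → width r ≡ d + width r′ → width s + width r ≡ d + (width s + width r′)
    right r r′ s eq = trans (+-comm (width s) (width r))
      (trans (left r r′ s eq) (cong (d +_) (+-comm (width r′) (width s))))
    go : (C : Context) (r r′ : RegExp A) → width r ≡ d + width r′ → width (plug C r) ≡ d + width (plug C r′)
    go □        r r′ eq = eq
    go (C ⊙ˡ s) r r′ eq = go C (r ⊙ s) (r′ ⊙ s) (left r r′ s eq)
    go (C ⊙ʳ s) r r′ eq = go C (s ⊙ r) (s ⊙ r′) (right r r′ s eq)
    go (C ⊕ˡ s) r r′ eq = go C (r ⊕ s) (r′ ⊕ s) (left r r′ s eq)
    go (C ⊕ʳ s) r r′ eq = go C (s ⊕ r) (s ⊕ r′) (right r r′ s eq)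
    go (C ⋆)    r r′ eq = go C (r ⋆) (r′ ⋆) eq

  -- Where the cut between `x` and `y` falls relative to `m`. Because of the condition on `γ`,
  -- `position` reports a cut at the right end of `m` as `within`; this spares a boundary case in
  -- `Replaces-⊙ʳ`.
  data Position (α m β x y : List A) : Set where
    before : ∀ γ → α ≡ x ++ γ → y ≡ γ ++ m ++ β → Position α m β x y
    within : ∀ m₁ m₂ → m ≡ m₁ ++ m₂ → x ≡ α ++ m₁ → y ≡ m₂ ++ β → Position α m β x y
    after  : ∀ γ → γ ≢ [] → x ≡ α ++ m ++ γ → β ≡ γ ++ y → Position α m β x y

  position : ∀ α m β x y → α ++ m ++ β ≡ x ++ y → Position α m β x y
  position α m β x y eq with ++-split α x eq
  ... | inj₁ (γ , p , q) = before γ p q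
  ... | inj₂ (γ , p , q) with ++-split m γ q
  ...   | inj₁ (δ , p′ , q′) = within γ δ p′ p q′
  ...   | inj₂ (δ , refl , q′) with []-or-≢[] δ
  ...     | inj₁ refl = within m [] (≡-sym (++-identityʳ m)) (trans p (cong (α ++_) (++-identityʳ m))) (≡-sym q′)
  ...     | inj₂ δ≢ = after δ δ≢ p q′

  -- Replacing a starred subexpression by the empty word.

  module _ (t : RegExp A) where

    -- The insertion point has to lie in `m`, ends included: in the application `m` is a code, and
    -- only a cut of `m` itself leads to a vertex visited by that code.
    record Cut (r : RegExp A) (α m β : List A) : Set where
      constructor cut
      field
        {m₁ m₂} : List A
        split   : m ≡ m₁ ++ m₂
        insert  : ∀ {z} → L⟦ t ⋆ ⟧ z → L⟦ r ⟧ ((α ++ m₁) ++ z ++ (m₂ ++ β))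

    Cut-map : {r r′ : RegExp A} {α m β α′ β′ : List A} (u v : List A) → α′ ≡ u ++ α → β′ ≡ β ++ v →
              (∀ {x} → L⟦ r ⟧ x → L⟦ r′ ⟧ (u ++ x ++ v)) → Cut r α m β → Cut r′ α′ m β′
    Cut-map {r′ = r′} {α} {β = β} u v refl refl f (cut {m₁} {m₂} eq ins) =
      cut eq λ {z} p → subst L⟦ r′ ⟧ (++-assoc₂ u α m₁ z m₂ β v) (f (ins p))

    -- The implications keep track of occurrences that reach the ends of the
    -- word, so that they can be concatenated.
    record Kept (r : RegExp A) (α m β : List A) : Set where
      constructor kept
      field
        {α′ β′} : List A
        member  : L⟦ r ⟧ (α′ ++ m ++ β′)
        left    : α ≡ [] → α′ ≡ []
        right   : β ≡ [] → β′ ≡ []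

    -- The outer parts are nonempty so that this case drops out when an occurrence is split at a
    -- boundary and a piece is traced with one side empty. Nothing is lost: an occurrence reaching
    -- an end of its iteration touches an insertion point.
    Inside : List A → List A → List A → Set
    Inside α m β = α ≢ [] × β ≢ [] × Covers t m

    -- `r′` is `r` with an occurrence of `t ⋆` replaced by `εᵣ`.
    record Replaces (r r′ : RegExp A) : Set where
      field
        sound     : L⟦ r′ ⟧ ⊆ L⟦ r ⟧
        inhabited : ∀ {x} → L⟦ r ⟧ x → ∃[ y ] L⟦ r′ ⟧ y
        trace     : ∀ α m β → L⟦ r ⟧ (α ++ m ++ β) →
                    Cut r α m β ⊎ Inside α m β ⊎ Kept r′ α m β

    open Replaces

    -- The boundaries between iterations are insertion points. If `m` contains or touches one, it is
    -- cut there; otherwise it lies strictly inside a single word of `t`.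
    ⋆-trace : ∀ us α m β → All L⟦ t ⟧ us → α ++ m ++ β ≡ concat us →
              Cut (t ⋆) α m β ⊎ Inside α m β
    ⋆-trace [] [] [] [] [] refl = inj₁ (cut {m₁ = []} {m₂ = []} refl λ {z} p → subst L⟦ t ⋆ ⟧ (≡-sym (++-identityʳ z)) p)
    ⋆-trace (u ∷ us) α m β (pu ∷ pus) eq with ++-split α u eq
    ... | inj₁ (γ , refl , eq′) with ⋆-trace us γ m β pus (≡-sym eq′)
    ...   | inj₁ c = inj₁ (Cut-map u [] refl (≡-sym (++-identityʳ β))
                       (λ {x} p → subst L⟦ t ⋆ ⟧ (cong (u ++_) (≡-sym (++-identityʳ x))) (*-∷ pu p)) c)
    ...   | inj₂ (γ≢ , β≢ , cov) = inj₂ (≢[]-++ʳ γ≢ , β≢ , cov)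
    ⋆-trace (u ∷ us) α m β (pu ∷ pus) eq | inj₂ (γ , refl , eq′) with ++-split m γ eq′
    ... | inj₁ (δ , refl , eq″) = inj₁ (cut refl λ p →
            *-∷ pu (*-++ p (us , pus , ≡-sym eq″)))
    ... | inj₂ (δ , refl , refl) with []-or-≢[] α | []-or-≢[] δ
    ...   | inj₁ refl | _ = inj₁ (cut {m₁ = []} refl λ p → *-++ p (_ ∷ us , pu ∷ pus , eq))
    ...   | inj₂ _ | inj₁ refl = inj₁ (cut {m₂ = []} (≡-sym (++-identityʳ m)) λ p →
              *-∷ (subst L⟦ t ⟧ (cong (α ++_) (++-identityʳ m)) pu) (*-++ p (us , pus , refl)))
    ...   | inj₂ α≢ | inj₂ δ≢ = inj₂ (α≢ , ≢[]-++ˡ δ≢ , α , δ , pu)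

    Replaces-□ : Replaces (t ⋆) εᵣ
    Replaces-□ .sound refl = [] , [] , refl
    Replaces-□ .inhabited _ = [] , refl
    Replaces-□ .trace α m β (us , pus , eq) with ⋆-trace us α m β pus eq
    ... | inj₁ c = inj₁ c
    ... | inj₂ i = inj₂ (inj₁ i)

    Kept-map : {r r′ : RegExp A} {α m β : List A} → L⟦ r ⟧ ⊆ L⟦ r′ ⟧ → Kept r α m β → Kept r′ α m β
    Kept-map f (kept p l r) = kept (f p) l r

    Replaces-⊕ˡ : {r r′ : RegExp A} (s : RegExp A) → Replaces r r′ → Replaces (r ⊕ s) (r′ ⊕ s)
    Replaces-⊕ˡ s R .sound (inj₁ p) = inj₁ (sound R p)
    Replaces-⊕ˡ s R .sound (inj₂ p) = inj₂ p
    Replaces-⊕ˡ s R .inhabited (inj₁ p) with inhabited R p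
    ... | y , q = y , inj₁ q
    Replaces-⊕ˡ s R .inhabited {x} (inj₂ p) = x , inj₂ p
    Replaces-⊕ˡ s R .trace α m β (inj₂ p) = inj₂ (inj₂ (kept (inj₂ p) (λ e → e) (λ e → e)))
    Replaces-⊕ˡ s R .trace α m β (inj₁ p) with trace R α m β p
    ... | inj₁ (cut eq ins)  = inj₁ (cut eq λ z → inj₁ (ins z))
    ... | inj₂ (inj₁ i)      = inj₂ (inj₁ i)
    ... | inj₂ (inj₂ k)      = inj₂ (inj₂ (Kept-map inj₁ k))

    Replaces-⊕ʳ : {r r′ : RegExp A} (s : RegExp A) → Replaces r r′ → Replaces (s ⊕ r) (s ⊕ r′)
    Replaces-⊕ʳ s R .sound (inj₁ p) = inj₁ p
    Replaces-⊕ʳ s R .sound (inj₂ p) = inj₂ (sound R p)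
    Replaces-⊕ʳ s R .inhabited (inj₂ p) with inhabited R p
    ... | y , q = y , inj₂ q
    Replaces-⊕ʳ s R .inhabited {x} (inj₁ p) = x , inj₁ p
    Replaces-⊕ʳ s R .trace α m β (inj₁ p) = inj₂ (inj₂ (kept (inj₁ p) (λ e → e) (λ e → e)))
    Replaces-⊕ʳ s R .trace α m β (inj₂ p) with trace R α m β p
    ... | inj₁ (cut eq ins)  = inj₁ (cut eq λ z → inj₂ (ins z))
    ... | inj₂ (inj₁ i)      = inj₂ (inj₁ i)
    ... | inj₂ (inj₂ k)      = inj₂ (inj₂ (Kept-map inj₂ k))

    -- If the occurrence crosses the boundary, only its part `m₁` is traced, with nothing to its
    -- right: `Inside` is then impossible, and a kept `m₁` still ends its word, so that `m₂` can
    -- follow. If the occurrence lies in the second factor, the first word is exchanged for any word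
    -- of `r′`.
    Replaces-⊙ˡ : {r r′ : RegExp A} (s : RegExp A) → Replaces r r′ → Replaces (r ⊙ s) (r′ ⊙ s)
    Replaces-⊙ˡ s R .sound (u , v , pu , pv , eq) = u , v , sound R pu , pv , eq
    Replaces-⊙ˡ s R .inhabited (u , v , pu , pv , eq) with inhabited R pu
    ... | u′ , pu′ = u′ ++ v , u′ , v , pu′ , pv , refl
    Replaces-⊙ˡ {r} {r′} s R .trace α m β (x , y , px , py , eq) with position α m β x y eq
    ... | after γ γ≢ refl refl with trace R α m γ px
    ...   | inj₁ c = inj₁ (Cut-map [] y refl refl (λ p → _ , y , p , py , refl) c)
    ...   | inj₂ (inj₁ (a , b , c)) = inj₂ (inj₁ (a , ≢[]-++ˡ b , c))
    ...   | inj₂ (inj₂ (kept {α′} {β′} p l r)) =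
              inj₂ (inj₂ (kept (_ , y , p , py , ++-assoc₃ α′ m β′ y) l λ e → ⊥-elim (γ≢ (++-conicalˡ γ y e))))
    Replaces-⊙ˡ {r} {r′} s R .trace α m β (x , y , px , py , eq)
        | within m₁ m₂ refl refl refl with trace R α m₁ [] (subst L⟦ r ⟧ (cong (α ++_) (≡-sym (++-identityʳ m₁))) px)
    ... | inj₁ (cut {n₁} {n₂} refl ins) = inj₁ (cut (++-assoc n₁ n₂ m₂) λ {z} p →
            _ , m₂ ++ β , ins p , py , ++-assoc₆ (α ++ n₁) z n₂ m₂ β)
    ... | inj₂ (inj₁ (_ , b , _)) = ⊥-elim (b refl)
    ... | inj₂ (inj₂ (kept {α′} {β′} p l r)) with r refl
    ...   | refl = inj₂ (inj₂ (kept (_ , m₂ ++ β , p , py , ++-assoc₄ α′ m₁ m₂ β) l λ e → e))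
    Replaces-⊙ˡ {r} {r′} s R .trace α m β (x , y , px , py , eq)
        | before γ refl refl with []-or-≢[] x
    ... | inj₂ x≢ with inhabited R px
    ...   | x′ , px′ = inj₂ (inj₂ (kept {α′ = x′ ++ γ} (x′ , γ ++ m ++ β , px′ , py , ++-assoc x′ γ (m ++ β))
                         (λ e → ⊥-elim (x≢ (++-conicalˡ x γ e))) λ e → e))
    Replaces-⊙ˡ {r} {r′} s R .trace α m β (x , y , px , py , eq)
        | before γ refl refl | inj₁ refl with []-or-≢[] γ
    ... | inj₂ γ≢ with inhabited R px
    ...   | x′ , px′ = inj₂ (inj₂ (kept {α′ = x′ ++ γ} (x′ , γ ++ m ++ β , px′ , py , ++-assoc x′ γ (m ++ β))
                         (λ e → ⊥-elim (γ≢ e)) λ e → e))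
    -- With nothing before `m`, `left` requires the word taken from `r′` to be empty. Tracing the
    -- empty word in `r` either shows that `r′` contains it or gives an insertion point, which is
    -- then the left end of `m`.
    Replaces-⊙ˡ {r} {r′} s R .trace α m β (x , y , px , py , eq)
        | before γ refl refl | inj₁ refl | inj₁ refl with trace R [] [] [] px
    ... | inj₁ (cut {[]} {[]} refl ins) = inj₁ (cut {m₁ = []} refl λ {z} p →
            _ , m ++ β , ins p , py , cong (_++ m ++ β) (≡-sym (++-identityʳ z)))
    ... | inj₂ (inj₁ (a , _ , _)) = ⊥-elim (a refl)
    ... | inj₂ (inj₂ (kept {α′} {β′} p l r)) with l refl | r refl
    ...   | refl | refl = inj₂ (inj₂ (kept {α′ = []} ([] , m ++ β , p , py , refl) (λ e → e) λ e → e))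

    -- The mirror image of `Replaces-⊙ˡ`, without its last case: in `after` the part `γ` of `β` is
    -- nonempty, so `right` holds vacuously.
    Replaces-⊙ʳ : {r r′ : RegExp A} (s : RegExp A) → Replaces r r′ → Replaces (s ⊙ r) (s ⊙ r′)
    Replaces-⊙ʳ s R .sound (u , v , pu , pv , eq) = u , v , pu , sound R pv , eq
    Replaces-⊙ʳ s R .inhabited (u , v , pu , pv , eq) with inhabited R pv
    ... | v′ , pv′ = u ++ v′ , u , v′ , pu , pv′ , refl
    Replaces-⊙ʳ {r} {r′} s R .trace α m β (x , y , px , py , eq) with position α m β x y eq
    ... | before γ refl refl with trace R γ m β py
    ...   | inj₁ c = inj₁ (Cut-map x [] refl (≡-sym (++-identityʳ β))
              (λ {w} p → x , w , px , p , cong (x ++_) (++-identityʳ w)) c)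
    ...   | inj₂ (inj₁ (a , b , c)) = inj₂ (inj₁ (≢[]-++ʳ a , b , c))
    ...   | inj₂ (inj₂ (kept {α′} {β′} p l r)) =
              inj₂ (inj₂ (kept {α′ = x ++ α′} (x , _ , px , p , ++-assoc x α′ (m ++ β′))
                (λ e → trans (cong₂ _++_ (++-conicalˡ x γ e) (l (++-conicalʳ x γ e))) refl) r))
    Replaces-⊙ʳ {r} {r′} s R .trace α m β (x , y , px , py , eq)
        | within m₁ m₂ refl refl refl with trace R [] m₂ β py
    ... | inj₁ (cut {n₁} {n₂} refl ins) = inj₁ (cut (≡-sym (++-assoc m₁ n₁ n₂)) λ {z} p →
            α ++ m₁ , _ , px , ins p , ++-assoc₇ α m₁ n₁ (z ++ n₂ ++ β))
    ... | inj₂ (inj₁ (a , _ , _)) = ⊥-elim (a refl)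
    ... | inj₂ (inj₂ (kept {α′} {β′} p l r)) with l refl
    ...   | refl = inj₂ (inj₂ (kept (α ++ m₁ , _ , px , p , ++-assoc₅ α m₁ m₂ β′) (λ e → e) r))
    Replaces-⊙ʳ {r} {r′} s R .trace α m β (x , y , px , py , eq)
        | after γ γ≢ refl refl with inhabited R py
    ... | y′ , py′ = inj₂ (inj₂ (kept (_ , y′ , px , py′ , ++-assoc₃ α m γ y′) (λ e → e)
                       λ e → ⊥-elim (γ≢ (++-conicalˡ γ y e))))

    -- Iterations that do not meet `m` are dropped instead of being replaced. The pieces of `m` in
    -- the remaining ones are glued together, which `left` and `right` permit.
    ⋆-Replaces : {r r′ : RegExp A} → Replaces r r′ → ∀ us α m β → All L⟦ r ⟧ us → α ++ m ++ β ≡ concat us →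
                 Cut (r ⋆) α m β ⊎ Inside α m β ⊎ Kept (r′ ⋆) α m β
    ⋆-Replaces R [] [] [] [] [] refl = inj₂ (inj₂ (kept ([] , [] , refl) (λ e → e) λ e → e))
    ⋆-Replaces {r} {r′} R (u ∷ us) α m β (pu ∷ pus) eq with position α m β u (concat us) eq
    ... | before γ refl eq′ with ⋆-Replaces R us γ m β pus (≡-sym eq′)
    ...   | inj₁ c = inj₁ (Cut-map u [] refl (≡-sym (++-identityʳ β))
              (λ {w} p → subst L⟦ r ⋆ ⟧ (cong (u ++_) (≡-sym (++-identityʳ w))) (*-∷ pu p)) c)
    ...   | inj₂ (inj₁ (a , b , c)) = inj₂ (inj₁ (≢[]-++ʳ a , b , c))
    ...   | inj₂ (inj₂ (kept p l r)) = inj₂ (inj₂ (kept p (λ e → l (++-conicalʳ u γ e)) r))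
    ⋆-Replaces {r} {r′} R (u ∷ us) α m β (pu ∷ pus) eq | after γ γ≢ refl refl with trace R α m γ pu
    ... | inj₁ c = inj₁ (Cut-map [] (concat us) refl refl (λ p → *-∷ p (us , pus , refl)) c)
    ... | inj₂ (inj₁ (a , b , c)) = inj₂ (inj₁ (a , ≢[]-++ˡ b , c))
    ... | inj₂ (inj₂ (kept p l r)) = inj₂ (inj₂ (kept (*-embed p) l λ e → ⊥-elim (γ≢ (++-conicalˡ γ _ e))))
    ⋆-Replaces {r} {r′} R (u ∷ us) α m β (pu ∷ pus) eq | within m₁ m₂ refl refl eq′
        with trace R α m₁ [] (subst L⟦ r ⟧ (cong (α ++_) (≡-sym (++-identityʳ m₁))) pu)
           | ⋆-Replaces R us [] m₂ β pus (≡-sym eq′)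
    ... | inj₁ (cut {n₁} {n₂} refl ins) | _ = inj₁ (cut (++-assoc n₁ n₂ m₂) λ {z} p →
            subst L⟦ r ⋆ ⟧ (≡-sym (++-assoc₆ (α ++ n₁) z n₂ m₂ β)) (*-∷ (ins p) (us , pus , ≡-sym eq′)))
    ... | inj₂ (inj₁ (_ , b , _)) | _ = ⊥-elim (b refl)
    ... | inj₂ (inj₂ _) | inj₁ (cut {n₁} {n₂} refl ins) = inj₁ (cut (≡-sym (++-assoc m₁ n₁ n₂)) λ {z} p →
            subst L⟦ r ⋆ ⟧ (≡-sym (++-assoc₇ α m₁ n₁ (z ++ n₂ ++ β))) (*-∷ pu (ins p)))
    ... | inj₂ (inj₂ _) | inj₂ (inj₁ (a , _ , _)) = ⊥-elim (a refl)
    ... | inj₂ (inj₂ (kept {α′} p l r)) | inj₂ (inj₂ (kept {β′ = β″} p′ l′ r′₁)) with r refl | l′ refl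
    ...   | refl | refl = inj₂ (inj₂ (kept (subst L⟦ r′ ⋆ ⟧ (≡-sym (++-assoc₄ α′ m₁ m₂ β″)) (*-∷ p p′)) l r′₁))

    Replaces-⋆ : {r r′ : RegExp A} → Replaces r r′ → Replaces (r ⋆) (r′ ⋆)
    Replaces-⋆ {r} {r′} R .sound (us , pus , eq) = us , All-map (sound R) pus , eq
    Replaces-⋆ R .inhabited _ = [] , [] , [] , refl
    Replaces-⋆ R .trace α m β (us , pus , eq) = ⋆-Replaces R us α m β pus eq

    Replaces-plug : (C : Context) {r r′ : RegExp A} → Replaces r r′ → Replaces (plug C r) (plug C r′)
    Replaces-plug □        R = R
    Replaces-plug (C ⊙ˡ s) R = Replaces-plug C (Replaces-⊙ˡ s R)
    Replaces-plug (C ⊙ʳ s) R = Replaces-plug C (Replaces-⊙ʳ s R)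
    Replaces-plug (C ⊕ˡ s) R = Replaces-plug C (Replaces-⊕ˡ s R)
    Replaces-plug (C ⊕ʳ s) R = Replaces-plug C (Replaces-⊕ʳ s R)
    Replaces-plug (C ⋆)    R = Replaces-plug C (Replaces-⋆ R)

-- Letter occurrences, width and size; parsing at a separator letter.

module _ {A : Set} where

  ∈-*⁻ : {L : Language A} {a : A} (us : List (List A)) → All L us → a ∈ concat us → ∃[ u ] (L u × a ∈ u)
  ∈-*⁻ (u ∷ us) (pu ∷ pus) i with ∈-++⁻ u i
  ... | inj₁ j = u , pu , j
  ... | inj₂ j = ∈-*⁻ us pus j

  occurs⇒1≤width : (r : RegExp A) {x : List A} {a : A} → L⟦ r ⟧ x → a ∈ x → 1 ≤ width r
  occurs⇒1≤width (sym _) refl _ = s≤s z≤n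
  occurs⇒1≤width (r ⊙ s) (u , v , pu , pv , refl) i with ∈-++⁻ u i
  ... | inj₁ j = ≤-trans (occurs⇒1≤width r pu j) (m≤m+n _ _)
  ... | inj₂ j = ≤-trans (occurs⇒1≤width s pv j) (m≤n+m _ _)
  occurs⇒1≤width (r ⊕ s) (inj₁ p) i = ≤-trans (occurs⇒1≤width r p i) (m≤m+n _ _)
  occurs⇒1≤width (r ⊕ s) (inj₂ p) i = ≤-trans (occurs⇒1≤width s p i) (m≤n+m _ _)
  occurs⇒1≤width (r ⋆) (us , pus , refl) i with ∈-*⁻ us pus i
  ... | u , pu , j = occurs⇒1≤width r pu j
  occurs⇒1≤width εᵣ refl ()

  -- This yields the base case `2 ^ 1` of the induction, with `$` and `♯` as the two letters. There
  -- are two words `x` and `y` because under a star the letters may come from different iterations.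
  occur⇒2≤width : (r : RegExp A) {x y : List A} {a b : A} → a ≢ b → L⟦ r ⟧ x → a ∈ x → L⟦ r ⟧ y → b ∈ y → 2 ≤ width r
  occur⇒2≤width εᵣ _ refl ()
  occur⇒2≤width (sym _) ne refl (here refl) refl (here refl) = ⊥-elim (ne refl)
  occur⇒2≤width (r ⊙ s) ne (u , v , pu , pv , refl) i (u′ , v′ , pu′ , pv′ , refl) j with ∈-++⁻ u i | ∈-++⁻ u′ j
  ... | inj₁ i′ | inj₁ j′ = ≤-trans (occur⇒2≤width r ne pu i′ pu′ j′) (m≤m+n _ _)
  ... | inj₁ i′ | inj₂ j′ = +-mono-≤ (occurs⇒1≤width r pu i′) (occurs⇒1≤width s pv′ j′)
  ... | inj₂ i′ | inj₁ j′ = +-mono-≤ (occurs⇒1≤width r pu′ j′) (occurs⇒1≤width s pv i′)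
  ... | inj₂ i′ | inj₂ j′ = ≤-trans (occur⇒2≤width s ne pv i′ pv′ j′) (m≤n+m _ _)
  occur⇒2≤width (r ⊕ s) ne (inj₁ p) i (inj₁ q) j = ≤-trans (occur⇒2≤width r ne p i q j) (m≤m+n _ _)
  occur⇒2≤width (r ⊕ s) ne (inj₁ p) i (inj₂ q) j = +-mono-≤ (occurs⇒1≤width r p i) (occurs⇒1≤width s q j)
  occur⇒2≤width (r ⊕ s) ne (inj₂ p) i (inj₁ q) j = +-mono-≤ (occurs⇒1≤width r q j) (occurs⇒1≤width s p i)
  occur⇒2≤width (r ⊕ s) ne (inj₂ p) i (inj₂ q) j = ≤-trans (occur⇒2≤width s ne p i q j) (m≤n+m _ _)
  occur⇒2≤width (r ⋆) ne (us , pus , refl) i (vs , pvs , refl) j with ∈-*⁻ us pus i | ∈-*⁻ vs pvs j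
  ... | u , pu , i′ | v , pv , j′ = occur⇒2≤width r ne pu i′ pv j′

  1≤sizeᵣ : (r : RegExp A) → 1 ≤ sizeᵣ r
  1≤sizeᵣ ∅ᵣ      = ≤-refl
  1≤sizeᵣ εᵣ      = ≤-refl
  1≤sizeᵣ (sym _) = ≤-refl
  1≤sizeᵣ (r ⊙ s) = m≤n+m 1 _
  1≤sizeᵣ (r ⊕ s) = m≤n+m 1 _
  1≤sizeᵣ (r ⋆)   = m≤n+m 1 _

  sizeᵣ≤sizeᵣ-plug : (C : Context) (r : RegExp A) → sizeᵣ r ≤ sizeᵣ (plug C r)
  sizeᵣ≤sizeᵣ-plug □        r = ≤-refl
  sizeᵣ≤sizeᵣ-plug (C ⊙ˡ s) r = ≤-trans (≤-trans (m≤m+n _ _) (m≤m+n _ 1)) (sizeᵣ≤sizeᵣ-plug C (r ⊙ s))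
  sizeᵣ≤sizeᵣ-plug (C ⊙ʳ s) r = ≤-trans (≤-trans (m≤n+m _ (sizeᵣ s)) (m≤m+n _ 1)) (sizeᵣ≤sizeᵣ-plug C (s ⊙ r))
  sizeᵣ≤sizeᵣ-plug (C ⊕ˡ s) r = ≤-trans (≤-trans (m≤m+n _ _) (m≤m+n _ 1)) (sizeᵣ≤sizeᵣ-plug C (r ⊕ s))
  sizeᵣ≤sizeᵣ-plug (C ⊕ʳ s) r = ≤-trans (≤-trans (m≤n+m _ (sizeᵣ s)) (m≤m+n _ 1)) (sizeᵣ≤sizeᵣ-plug C (s ⊕ r))
  sizeᵣ≤sizeᵣ-plug (C ⋆)    r = ≤-trans (m≤m+n _ 1) (sizeᵣ≤sizeᵣ-plug C (r ⋆))

  width≤sizeᵣ : (r : RegExp A) → width r ≤ sizeᵣ r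
  width≤sizeᵣ ∅ᵣ      = z≤n
  width≤sizeᵣ εᵣ      = z≤n
  width≤sizeᵣ (sym _) = ≤-refl
  width≤sizeᵣ (r ⊙ s) = ≤-trans (+-mono-≤ (width≤sizeᵣ r) (width≤sizeᵣ s)) (m≤m+n _ 1)
  width≤sizeᵣ (r ⊕ s) = ≤-trans (+-mono-≤ (width≤sizeᵣ r) (width≤sizeᵣ s)) (m≤m+n _ 1)
  width≤sizeᵣ (r ⋆)   = ≤-trans (width≤sizeᵣ r) (m≤m+n _ 1)

  ++-skip : {c : A} {p q a d : List A} → c ∉ p → p ++ q ≡ a ++ c ∷ d → ∃[ ws ] (a ≡ p ++ ws × q ≡ ws ++ c ∷ d)
  ++-skip {p = []} {a = a} ∉p eq = a , refl , eq
  ++-skip {p = x ∷ p} {a = []} ∉p eq = ⊥-elim (∉p (here (≡-sym (∷-injectiveˡ eq))))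
  ++-skip {p = x ∷ p} {a = y ∷ a} ∉p eq with ∷-injective eq
  ... | refl , eq′ with ++-skip (∉p ∘ there) eq′
  ...   | ws , refl , q≡ = ws , refl , q≡

  first-unique : {c : A} {p q a d : List A} → c ∉ p → c ∉ a → p ++ c ∷ q ≡ a ++ c ∷ d → p ≡ a × q ≡ d
  first-unique {p = p} ∉p ∉a eq with ++-skip ∉p eq
  ... | []     , refl , eq′ = ≡-sym (++-identityʳ p) , ∷-injectiveʳ eq′
  ... | w ∷ ws , refl , eq′ = ⊥-elim (∉a (∈-++⁺ʳ p (here (∷-injectiveˡ eq′))))

  ∉-++ : {c : A} {p q : List A} → c ∉ p → c ∉ q → c ∉ p ++ q
  ∉-++ {p = p} ∉p ∉q i with ∈-++⁻ p i
  ... | inj₁ j = ∉p j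
  ... | inj₂ j = ∉q j

  module _ (_≟_ : DecidableEquality A) where

    first-occurrence : {c : A} {x : List A} → c ∈ x → ∃[ p ] ∃[ q ] (x ≡ p ++ c ∷ q × c ∉ p)
    first-occurrence {c} {y ∷ x} i with c ≟ y
    ... | yes refl = [] , x , refl , λ ()
    first-occurrence {c} {y ∷ x} (here eq) | no c≢y = ⊥-elim (c≢y eq)
    first-occurrence {c} {y ∷ x} (there i) | no c≢y with first-occurrence i
    ... | p , q , refl , ∉p = y ∷ p , q , refl , λ { (here eq) → c≢y eq ; (there j) → ∉p j }

    last-occurrence : {c : A} {x : List A} → c ∈ x → ∃[ p ] ∃[ q ] (x ≡ p ++ c ∷ q × c ∉ q)
    last-occurrence {c} {y ∷ x} i with member? _≟_ c x
    last-occurrence {c} {y ∷ x} i | yes j with last-occurrence j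
    ... | p , q , refl , ∉q = y ∷ p , q , refl , ∉q
    last-occurrence {c} {y ∷ x} (here refl) | no ∉x = [] , x , refl , ∉x
    last-occurrence {c} {y ∷ x} (there j)   | no ∉x = ⊥-elim (∉x j)

-- The binary encoding and its injectivity.

_≟ₖ_ : DecidableEquality ΣK
𝟘 ≟ₖ 𝟘 = yes refl
𝟘 ≟ₖ 𝟙 = no λ ()
𝟘 ≟ₖ $ = no λ ()
𝟘 ≟ₖ ♯ = no λ ()
𝟙 ≟ₖ 𝟘 = no λ ()
𝟙 ≟ₖ 𝟙 = yes refl
𝟙 ≟ₖ $ = no λ ()
𝟙 ≟ₖ ♯ = no λ ()
$ ≟ₖ 𝟘 = no λ ()
$ ≟ₖ 𝟙 = no λ ()
$ ≟ₖ $ = yes refl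
$ ≟ₖ ♯ = no λ ()
♯ ≟ₖ 𝟘 = no λ ()
♯ ≟ₖ 𝟙 = no λ ()
♯ ≟ₖ $ = no λ ()
♯ ≟ₖ ♯ = yes refl

-- Strong induction through `⌈ n /2⌉`, whose logarithm is smaller by one. It ensures that `enc` has
-- enough digits to be injective.
n≤2^⌈log₂n⌉ : ∀ n → n ≤ 2 ^ ⌈log₂ n ⌉
n≤2^⌈log₂n⌉ = <-rec _ go
  where
  unhalve : ∀ n b {c} → 1 ≤ b → c ≡ b ∸ 1 → ⌈ n /2⌉ ≤ 2 ^ c → n ≤ 2 ^ b
  unhalve n (suc b) _ refl le = begin
    n                   ≡⟨ ⌊n/2⌋+⌈n/2⌉≡n n ⟨
    ⌊ n /2⌋ + ⌈ n /2⌉   ≤⟨ +-mono-≤ (≤-trans (⌊n/2⌋≤⌈n/2⌉ n) le) le ⟩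
    2 ^ b + 2 ^ b       ≡⟨ cong (2 ^ b +_) (+-identityʳ (2 ^ b)) ⟨
    2 ^ suc b           ∎
    where open ≤-Reasoning
  go : ∀ n → (∀ {m} → m < n → m ≤ 2 ^ ⌈log₂ m ⌉) → n ≤ 2 ^ ⌈log₂ n ⌉
  go 0 _ = z≤n
  go 1 _ = s≤s z≤n
  go n@(suc (suc n′)) rec =
    unhalve n ⌈log₂ n ⌉ (⌈log₂⌉-mono-≤ {2} {n} (s≤s (s≤s z≤n))) (⌈log₂⌈n/2⌉⌉≡⌈log₂n⌉∸1 n) (rec (⌈n/2⌉<n n′))

bits-binary : ∀ b m {c} → c ∈ bits b m → c ≡ 𝟘 ⊎ c ≡ 𝟙
bits-binary (suc b) m i with ∈-++⁻ (bits b (m / 2)) i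
... | inj₁ j = bits-binary b (m / 2) j
... | inj₂ j with m % 2
bits-binary (suc b) m i | inj₂ (here refl) | zero  = inj₁ refl
bits-binary (suc b) m i | inj₂ (here refl) | suc _ = inj₂ refl

bits-injective : ∀ b {m m′} → m < 2 ^ b → m′ < 2 ^ b → bits b m ≡ bits b m′ → m ≡ m′
bits-injective zero    {zero} {zero} _ _ _ = refl
bits-injective zero    {suc _} (s≤s ())
bits-injective zero    {_} {suc _} _ (s≤s ())
bits-injective (suc b) {m} {m′} lt lt′ eq = trans (m≡m%n+[m/n]*n m 2) (trans (cong₂ (λ r q → r + q * 2) %≡ /≡) (≡-sym (m≡m%n+[m/n]*n m′ 2)))
  where
  half : ∀ {k} → k < 2 ^ suc b → k / 2 < 2 ^ b
  half {k} l = m<n*o⇒m/o<n (subst (k <_) (*-comm 2 (2 ^ b)) l)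
  /≡ : m / 2 ≡ m′ / 2
  /≡ = bits-injective b (half lt) (half lt′) (proj₁ (∷ʳ-injective _ _ eq))
  %≡ : m % 2 ≡ m′ % 2
  %≡ with m % 2 | m′ % 2 | m%n<n m 2 | m%n<n m′ 2 | proj₂ (∷ʳ-injective (bits b (m / 2)) (bits b (m′ / 2)) eq)
  ... | zero        | zero        | _ | _ | _ = refl
  ... | suc zero    | suc zero    | _ | _ | _ = refl
  ... | suc (suc _) | _           | s≤s (s≤s ()) | _ | _
  ... | _           | suc (suc _) | _ | s≤s (s≤s ()) | _

-- Codes of vertex sequences.

module _ (n : ℕ) where

  private
    V : Set
    V = Fin n

    e : V → List ΣK
    e = enc n

  $∉enc : ∀ i → $ ∉ e i
  $∉enc i p with bits-binary ⌈log₂ n ⌉ (toℕ i) p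
  ... | inj₁ ()
  ... | inj₂ ()

  ♯∉enc : ∀ i → ♯ ∉ e i
  ♯∉enc i p with bits-binary ⌈log₂ n ⌉ (toℕ i) p
  ... | inj₁ ()
  ... | inj₂ ()

  enc-injective : ∀ {i j} → e i ≡ e j → i ≡ j
  enc-injective {i} {j} eq = toℕ-injective (bits-injective ⌈log₂ n ⌉ (small i) (small j) eq)
    where
    small : ∀ k → toℕ k < 2 ^ ⌈log₂ n ⌉
    small k = <-≤-trans (toℕ<n k) (n≤2^⌈log₂n⌉ n)

  block : V → V → List ΣK
  block i j = e j ++ $ ∷ e i ++ ♯ ∷ []

  -- Indexing by vertices instead of edges makes the chaining condition on letters automatic: every
  -- list of vertices is a path in the complete graph with loops. A single vertex is a path without
  -- edges.
  code : List V → List ΣK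
  code []           = []
  code (_ ∷ [])     = []
  code (i ∷ j ∷ vs) = block i j ++ code (j ∷ vs)

  code-∷ : ∀ i j vs → code (i ∷ j ∷ vs) ≡ e j ++ $ ∷ e i ++ ♯ ∷ code (j ∷ vs)
  code-∷ i j vs = trans (++-assoc (e j) _ _) (cong (λ x → e j ++ $ ∷ x) (++-assoc (e i) _ _))

  -- `x` is the block joining the last vertex of `us` to the first of `vs`, or empty if one of the
  -- lists is.
  code-++ : ∀ us vs → ∃[ x ] (code (us ++ vs) ≡ code us ++ x ++ code vs)
  code-++ []           vs       = [] , refl
  code-++ (i ∷ [])     []       = [] , refl
  code-++ (i ∷ [])     (j ∷ vs) = block i j , refl
  code-++ (i ∷ j ∷ us) vs with code-++ (j ∷ us) vs
  ... | x , eq = x , trans (cong (block i j ++_) eq) (≡-sym (++-assoc (block i j) (code (j ∷ us)) (x ++ code vs)))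

  code-infix : ∀ {us vs} → us Infix-of vs → code us Infix-of code vs
  code-infix {us} (as , bs , refl) with code-++ as (us ++ bs) | code-++ us bs
  ... | x , eq | y , eq′ = code as ++ x , y ++ code bs ,
    trans eq (trans (cong (λ z → code as ++ x ++ z) eq′) (≡-sym (++-assoc (code as) x _)))

  ρ-path : ∀ k (i : Fin (suc k) → V) → ρ n (tabulate (λ t → a[ i (inject₁ t) , i (suc t) ])) ≡ code (tabulate i)
  ρ-path zero    i = refl
  ρ-path (suc k) i = cong (block (i zero) (i (suc zero)) ++_) (ρ-path k (i ∘ suc))

  K⇒code : ∀ {w} → K n w → ∃[ i ] ∃[ j ] ∃[ vs ] w ≡ code (i ∷ j ∷ vs)
  K⇒code (_ , (suc k , i , _ , refl) , refl) = i zero , i (suc zero) , tabulate (λ (t : Fin k) → i (suc (suc t))) , ρ-path (suc k) i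

  code⇒K : ∀ i j vs → K n (code (i ∷ j ∷ vs))
  code⇒K i j vs = _ , (length (j ∷ vs) , lookup (i ∷ j ∷ vs) , s≤s z≤n , refl) ,
    ≡-sym (trans (ρ-path (length (j ∷ vs)) (lookup (i ∷ j ∷ vs))) (cong code (tabulate-lookup (i ∷ j ∷ vs))))

  -- A `♯` ends a block, so `s` begins with the first half of the next one. If `s` went beyond that
  -- half, it would contain its `$` and could reach another `$` only across a `♯`.
  ♯-segment : ∀ i vs {a s c} → ♯ ∉ s → code (i ∷ vs) ≡ a ++ ♯ ∷ s ++ $ ∷ c →
              ∃[ h ] ∃[ j ] ∃[ ws ] (j ∈ i ∷ vs × s ≡ e j × c ≡ e h ++ ♯ ∷ code (j ∷ ws))
  ♯-segment _ []           {[]}    _ ()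
  ♯-segment _ []           {_ ∷ _} _ ()
  ♯-segment i (j ∷ vs) {a} {s} {c} ∉s eq
      with ++-skip {p = e j ++ $ ∷ e i} {q = ♯ ∷ code (j ∷ vs)}
             (∉-++ (♯∉enc j) (λ { (there p) → ♯∉enc i p }))
             (trans (trans (++-assoc (e j) _ _) (≡-sym (code-∷ i j vs))) eq)
  ... | w ∷ ws , refl , eq′ with ♯-segment j vs ∉s (∷-injectiveʳ eq′)
  ...   | i′ , j′ , ws′ , j∈ , s≡ , c≡ = i′ , j′ , ws′ , there j∈ , s≡ , c≡
  ♯-segment i (j ∷ [])     {a} {[]}    {c} ∉s eq | [] , refl , ()
  ♯-segment i (j ∷ [])     {a} {_ ∷ _} {c} ∉s eq | [] , refl , ()
  ♯-segment i (j ∷ k ∷ vs) {a} {s} {c} ∉s eq | [] , refl , eq′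
      with ++-skip {p = e k} ($∉enc k) (trans (≡-sym (code-∷ j k vs)) (∷-injectiveʳ eq′))
  ... | [] , refl , eq″ = j , k , vs , there (there (here refl)) , ++-identityʳ (e k) , ≡-sym (∷-injectiveʳ eq″)
  ... | w ∷ ws , refl , eq″
      with ++-skip {p = e j ++ ♯ ∷ []} (∉-++ ($∉enc j) (λ { (here ()) }))
             (trans (++-assoc (e j) _ _) (∷-injectiveʳ eq″))
  ...   | ws′ , refl , _ = ⊥-elim (∉s (∈-++⁺ʳ (e k) (there (∈-++⁺ˡ (∈-++⁺ʳ (e j) (here refl))))))

  $-segment : ∀ i vs {a s c} → ♯ ∉ s → code (i ∷ vs) ≡ a ++ $ ∷ s ++ ♯ ∷ c → ∃[ j ] (j ∈ i ∷ vs × s ≡ e j)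
  $-segment _ []           {[]}    _ ()
  $-segment _ []           {_ ∷ _} _ ()
  $-segment i (j ∷ vs) {a} {s} {c} ∉s eq
      with ++-skip {p = e j} ($∉enc j) (trans (≡-sym (code-∷ i j vs)) eq)
  ... | [] , refl , eq′ = i , here refl , ≡-sym (proj₁ (first-unique (♯∉enc i) ∉s (∷-injectiveʳ eq′)))
  ... | w ∷ ws , refl , eq′
      with ++-skip {p = e i ++ ♯ ∷ []} (∉-++ ($∉enc i) (λ { (here ()) }))
             (trans (++-assoc (e i) _ _) (∷-injectiveʳ eq′))
  ...   | ws′ , refl , eq″ with $-segment j vs ∉s eq″
  ...     | v , v∈ , s≡ = v , there v∈ , s≡

  -- Here the swap of indices takes effect. The target of a block fills its first half and returns,
  -- as the source, in the second half of the next block. As `h` has no `$`, the two displayed `$`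
  -- belong to consecutive blocks.
  segments-agree : ∀ i vs {a s h s′ c} → ♯ ∉ s → $ ∉ h → ♯ ∉ s′ →
                   code (i ∷ vs) ≡ a ++ ♯ ∷ s ++ $ ∷ h ++ $ ∷ s′ ++ ♯ ∷ c → s ≡ s′
  segments-agree i₀ vs {h = h} ∉s ∉h ∉s′ eq with ♯-segment i₀ vs ∉s eq
  -- Without a further block only `e i` and `♯` would remain, which contain no second `$`.
  ... | i , j , [] , _ , refl , eq′ =
        ⊥-elim (∉-++ ($∉enc i) (λ { (here ()) }) (subst ($ ∈_) eq′ (∈-++⁺ʳ h (here refl))))
  ... | i , j , k ∷ ws , _ , refl , eq′
        with first-unique {p = e i ++ ♯ ∷ e k} (∉-++ ($∉enc i) (λ { (there p) → $∉enc k p })) ∉h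
               (trans (++-assoc (e i) _ _) (trans (cong (λ x → e i ++ ♯ ∷ x) (≡-sym (code-∷ j k ws))) (≡-sym eq′)))
  ...   | _ , eq″ = proj₁ (first-unique (♯∉enc j) ∉s′ eq″)

  -- Vertices forced at the ends of a factor.

  Factor : Language ΣK
  Factor = InfixClosure (K n)

  -- `Exit x s` and `Entry x s`: the vertex encoded by `s` is forced at the right,
  -- respectively left, end of `x`, wherever in a block that end lies.
  record Exit (x s : List ΣK) : Set where
    constructor exit
    field
      {p q} : List ΣK
      split : x ≡ p ++ ♯ ∷ s ++ $ ∷ q
      ♯∉s   : ♯ ∉ s
      $∉q   : $ ∉ q

  record Entry (x s : List ΣK) : Set where
    constructor entry
    field
      {p q} : List ΣK
      split : x ≡ p ++ $ ∷ s ++ ♯ ∷ q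
      $∉p   : $ ∉ p
      ♯∉s   : ♯ ∉ s

  Exit-Entry-agree : ∀ {x y s s′} → Exit x s → Entry y s′ → Factor (x ++ y) → s ≡ s′
  Exit-Entry-agree {s = s} {s′} (exit {p} {q} refl ∉s ∉q) (entry {p′} {q′} refl ∉p′ ∉s′) (u , v , k) with K⇒code k
  ... | i , j , vs , eq = segments-agree i (j ∷ vs) {a = u ++ p} ∉s (∉-++ ∉q ∉p′) ∉s′ (trans (≡-sym eq) eq′)
    where
    regroup : ∀ (u p a s b q p′ s′ q′ v : List ΣK) →
              u ++ ((p ++ a ++ s ++ b ++ q) ++ (p′ ++ b ++ s′ ++ a ++ q′)) ++ v ≡
              (u ++ p) ++ a ++ s ++ b ++ (q ++ p′) ++ b ++ s′ ++ a ++ (q′ ++ v)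
    regroup u p a s b q p′ s′ q′ v = solve (++-monoid ΣK)
    eq′ : u ++ ((p ++ ♯ ∷ s ++ $ ∷ q) ++ (p′ ++ $ ∷ s′ ++ ♯ ∷ q′)) ++ v ≡
          (u ++ p) ++ ♯ ∷ s ++ $ ∷ (q ++ p′) ++ $ ∷ s′ ++ ♯ ∷ (q′ ++ v)
    eq′ = regroup u p [ ♯ ] s [ $ ] q p′ s′ q′ v

  -- The last `$` of the word lies after the displayed `♯`, so some `♯` precedes it; `s` starts
  -- after the last such `♯`.
  ∃-Exit : ∀ a b c → ∃[ s ] Exit (a ++ ♯ ∷ b ++ $ ∷ c) s
  ∃-Exit a b c with last-occurrence _≟ₖ_ {$} {b ++ $ ∷ c} (∈-++⁺ʳ b (here refl))
  ... | p , q , eq , ∉q with last-occurrence _≟ₖ_ {♯} {a ++ ♯ ∷ p} (∈-++⁺ʳ a (here refl))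
  ...   | p′ , s , eq′ , ∉s = s , exit
          (trans (cong (λ x → a ++ ♯ ∷ x) eq) (trans (≡-sym (++-assoc a (♯ ∷ p) ($ ∷ q)))
            (trans (cong (_++ $ ∷ q) eq′) (++-assoc p′ (♯ ∷ s) ($ ∷ q))))) ∉s ∉q

  ∃-Entry : ∀ a b c → ∃[ s ] Entry (a ++ $ ∷ b ++ ♯ ∷ c) s
  ∃-Entry a b c with first-occurrence _≟ₖ_ {$} {a ++ $ ∷ b} (∈-++⁺ʳ a (here refl))
  ... | p , q , eq , ∉p with first-occurrence _≟ₖ_ {♯} {q ++ ♯ ∷ c} (∈-++⁺ʳ q (here refl))
  ...   | s , q′ , eq′ , ∉s = s , entry
          (trans (≡-sym (++-assoc a ($ ∷ b) (♯ ∷ c))) (trans (cong (_++ ♯ ∷ c) eq)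
            (trans (++-assoc p ($ ∷ q) (♯ ∷ c)) (cong (λ x → p ++ $ ∷ x) eq′)))) ∉p ∉s

  data Long : List V → Set where
    long : ∀ {i j k l vs} → Long (i ∷ j ∷ k ∷ l ∷ vs)

  Long-++ : ∀ {us vs} → Long us → Long (us ++ vs)
  Long-++ long = long


  -- Two overlapping blocks in the middle of a code, so that every cut of the
  -- code leaves one of the two factors intact.
  code-long : ∀ {i j k l vs} → code (i ∷ j ∷ k ∷ l ∷ vs) ≡
              (e j ++ $ ∷ e i ++ ♯ ∷ e k ++ $ ∷ []) ++ (e j ++ ♯ ∷ e l ++ $ ∷ e k ++ ♯ ∷ code (l ∷ vs))
  code-long {i} {j} {k} {l} {vs} = regroup (e i) (e j) (e k) (e l) [ $ ] [ ♯ ] (code (l ∷ vs))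
    where
    regroup : ∀ (i j k l a b x : List ΣK) →
              (j ++ a ++ i ++ b) ++ (k ++ a ++ j ++ b) ++ (l ++ a ++ k ++ b) ++ x ≡
              (j ++ a ++ i ++ b ++ k ++ a) ++ (j ++ b ++ l ++ a ++ k ++ b ++ x)
    regroup i j k l a b x = solve (++-monoid ΣK)

  code-cut : ∀ {vs m₁ m₂} → Long vs → code vs ≡ m₁ ++ m₂ → ∃[ s ] (Exit m₁ s ⊎ Entry m₂ s)
  code-cut {m₁ = m₁} {m₂} (long {i} {j} {k} {l} {vs}) eq
      with ++-split (e j ++ $ ∷ e i ++ ♯ ∷ e k ++ $ ∷ []) m₁ (trans (≡-sym (code-long {i} {j} {k} {l} {vs})) eq)
  ... | inj₁ (ws , _ , refl) with ∃-Entry (ws ++ e j ++ ♯ ∷ e l) (e k) (code (l ∷ vs))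
  ...   | s , en = s , inj₂ (subst (λ x → Entry x s)
            (regroup ws (e j) [ ♯ ] (e l) ($ ∷ e k ++ ♯ ∷ code (l ∷ vs))) en)
    where
    regroup : ∀ (a b c d x : List ΣK) → (a ++ b ++ c ++ d) ++ x ≡ a ++ b ++ c ++ d ++ x
    regroup a b c d x = solve (++-monoid ΣK)
  code-cut {m₁ = m₁} {m₂} (long {i} {j} {k} {l} {vs}) eq | inj₂ (ws , refl , _)
      with ∃-Exit (e j ++ $ ∷ e i) (e k) ws
  ... | s , ex = s , inj₁ (subst (λ x → Exit x s)
            (regroup (e j) [ $ ] (e i) [ ♯ ] (e k) ws) ex)
    where
    regroup : ∀ (a b c d x y : List ΣK) → (a ++ b ++ c) ++ d ++ x ++ b ++ y ≡ (a ++ b ++ c ++ d ++ x ++ b) ++ y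
    regroup a b c d x y = solve (++-monoid ΣK)

  code-∃-Exit : ∀ {vs y} → Long vs → code vs Infix-of y → ∃[ s ] Exit y s
  code-∃-Exit (long {i} {j} {k} {l} {vs}) (u , v , refl)
      with ∃-Exit (u ++ e j ++ $ ∷ e i) (e k) (e j ++ ♯ ∷ e l ++ $ ∷ e k ++ ♯ ∷ code (l ∷ vs) ++ v)
  ... | s , ex = s , subst (λ x → Exit x s) (regroup u v (e i) (e j) (e k) (e l) [ $ ] [ ♯ ] (code (l ∷ vs))) ex
    where
    regroup : ∀ (u v i j k l a b x : List ΣK) →
              (u ++ j ++ a ++ i) ++ b ++ k ++ a ++ (j ++ b ++ l ++ a ++ k ++ b ++ x ++ v) ≡
              u ++ ((j ++ a ++ i ++ b) ++ (k ++ a ++ j ++ b) ++ (l ++ a ++ k ++ b) ++ x) ++ v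
    regroup u v i j k l a b x = solve (++-monoid ΣK)

  code-∃-Entry : ∀ {vs y} → Long vs → code vs Infix-of y → ∃[ s ] Entry y s
  code-∃-Entry (long {i} {j} {k} {l} {vs}) (u , v , refl)
      with ∃-Entry (u ++ e j) (e i) (e k ++ $ ∷ e j ++ ♯ ∷ e l ++ $ ∷ e k ++ ♯ ∷ code (l ∷ vs) ++ v)
  ... | s , en = s , subst (λ x → Entry x s) (regroup u v (e i) (e j) (e k) (e l) [ $ ] [ ♯ ] (code (l ∷ vs))) en
    where
    regroup : ∀ (u v i j k l a b x : List ΣK) →
              (u ++ j) ++ a ++ i ++ b ++ (k ++ a ++ j ++ b ++ l ++ a ++ k ++ b ++ x ++ v) ≡
              u ++ ((j ++ a ++ i ++ b) ++ (k ++ a ++ j ++ b) ++ (l ++ a ++ k ++ b) ++ x) ++ v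
    regroup u v i j k l a b x = solve (++-monoid ΣK)

  Exit-code : ∀ {vs m₁ m₂ s} → code vs ≡ m₁ ++ m₂ → Exit m₁ s → ∃[ v ] (v ∈ vs × s ≡ e v)
  Exit-code {i ∷ vs} {m₂ = m₂} {s} eq (exit {p} {q} refl ∉s _)
      with ♯-segment i vs ∉s (trans eq (trans (++-assoc p _ m₂) (cong (λ x → p ++ ♯ ∷ x) (++-assoc s _ m₂))))
  ... | _ , j , _ , j∈ , s≡ , _ = j , j∈ , s≡
  Exit-code {[]} eq (exit {[]} refl _ _) with () ← eq
  Exit-code {[]} eq (exit {_ ∷ _} refl _ _) with () ← eq

  Entry-code : ∀ {vs m₁ m₂ s} → code vs ≡ m₁ ++ m₂ → Entry m₂ s → ∃[ v ] (v ∈ vs × s ≡ e v)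
  Entry-code {i ∷ vs} {m₁} eq (entry {p} refl _ ∉s) = $-segment i vs {a = m₁ ++ p} ∉s (trans eq (≡-sym (++-assoc m₁ p _)))
  Entry-code {[]} {[]} eq (entry {[]} refl _ _) with () ← eq
  Entry-code {[]} {[]} eq (entry {_ ∷ _} refl _ _) with () ← eq
  Entry-code {[]} {_ ∷ _} eq (entry refl _ _) with () ← eq

  -- One side of the cut retains a forced vertex. It is visited by `vs`, and it must agree with the
  -- vertex at the adjacent end of `y`. The use is contrapositive: `y` cannot be inserted into a
  -- code that avoids its vertex.
  cut-visits : ∀ {vs m₁ m₂ y s} → Long vs → code vs ≡ m₁ ++ m₂ → Exit y s → Entry y s →
               Factor (m₁ ++ y) → Factor (y ++ m₂) → ∃[ v ] (v ∈ vs × s ≡ e v)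
  cut-visits {vs} {m₁} lg eq ex en f₁ f₂ with code-cut {vs} {m₁} lg eq
  ... | s′ , inj₁ ex′ with Exit-code {vs} {m₁} eq ex′ | Exit-Entry-agree ex′ en f₁
  ...   | v , v∈ , s≡ | refl = v , v∈ , s≡
  cut-visits {vs} {m₁} lg eq ex en f₁ f₂ | s′ , inj₂ en′ with Entry-code {vs} {m₁} eq en′ | Exit-Entry-agree ex en′ f₂
  ...   | v , v∈ , s≡ | refl = v , v∈ , s≡

  -- Powers of vertex sequences and normal expressions.

  pow : ℕ → List V → List V
  pow m w = concat (replicate m w)

  pow-+ : ∀ a b w → pow (a + b) w ≡ pow a w ++ pow b w
  pow-+ zero    b w = refl
  pow-+ (suc a) b w = trans (cong (w ++_) (pow-+ a b w)) (≡-sym (++-assoc w (pow a w) (pow b w)))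

  ∈-pow⁻ : ∀ m {v w} → v ∈ pow m w → v ∈ w
  ∈-pow⁻ (suc m) {w = w} i with ∈-++⁻ w i
  ... | inj₁ j = j
  ... | inj₂ j = ∈-pow⁻ m j

  pow-infix : ∀ {a b w} → a ≤ b → pow a w Infix-of pow b w
  pow-infix {a} {w = w} le with m≤n⇒∃[o]m+o≡n le
  ... | d , refl = [] , pow d w , pow-+ a d w

  self-infix-pow : ∀ {m w} → 1 ≤ m → w Infix-of pow m w
  self-infix-pow {suc m} {w} _ = [] , pow m w , refl

  ∈-infix-concat : ∀ {xs : List V} {xss} → xs ∈ xss → xs Infix-of concat xss
  ∈-infix-concat {xss = xs ∷ xss} (here refl) = [] , concat xss , refl
  ∈-infix-concat {xs} {ys ∷ xss} (there i) with ∈-infix-concat i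
  ... | u , v , eq = ys ++ u , v , trans (cong (ys ++_) eq) (≡-sym (++-assoc ys u (xs ++ v)))

  Normal : RegExp ΣK → Set
  Normal r = L⟦ r ⟧ ⊆ Factor

  Covers-code : ∀ {r us vs} → us Infix-of vs → Covers r (code vs) → Covers r (code us)
  Covers-code {r} inf = InfixClosure-infix {L = L⟦ r ⟧} (code-infix inf)

  Covers-code⇒2≤width : ∀ {r vs} → Long vs → Covers r (code vs) → 2 ≤ width r
  Covers-code⇒2≤width {r} (long {i} {j} {k} {l} {vs}) (u , v , p) =
    occur⇒2≤width r {a = $} {♯} (λ ())
      p (∈-++⁺ʳ u (∈-++⁺ˡ (subst ($ ∈_) (≡-sym (code-∷ i j (k ∷ l ∷ vs))) (∈-++⁺ʳ (e j) (here refl)))))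
      p (∈-++⁺ʳ u (∈-++⁺ˡ (subst (♯ ∈_) (≡-sym (code-∷ i j (k ∷ l ∷ vs))) (∈-++⁺ʳ (e j) (there (∈-++⁺ʳ (e i) (here refl)))))))

  -- The boundary between the factors lies either after the first `a` copies or before the last `b`
  -- copies. A word of the other factor is returned because normality passes to a factor only if the
  -- other one is inhabited.
  Covers-⊙ : ∀ {r s a b w} → Covers (r ⊙ s) (code (pow (a + b) w)) →
             Covers r (code (pow a w)) × ∃[ y ] L⟦ s ⟧ y ⊎ Covers s (code (pow b w)) × ∃[ x ] L⟦ r ⟧ x
  Covers-⊙ {r} {s} {a} {b} {w} (u , v , x , y , px , py , eq) with code-++ (pow a w) (pow b w)
  ... | z , eq′ with ++-split x (u ++ code (pow a w)) (trans (≡-sym eq)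
                       (trans (cong (λ t → u ++ t ++ v) (trans (cong code (pow-+ a b w)) eq′))
                              (regroup u (code (pow a w)) z (code (pow b w)) v)))
    where
    regroup : ∀ (u c z d v : List ΣK) → u ++ (c ++ z ++ d) ++ v ≡ (u ++ c) ++ (z ++ d ++ v)
    regroup u c z d v = solve (++-monoid ΣK)
  ...   | inj₁ (ws , refl , _) = inj₁ ((u , ws , subst L⟦ r ⟧ (++-assoc u _ ws) px) , y , py)
  ...   | inj₂ (ws , _ , refl) = inj₂ ((ws ++ z , v , subst L⟦ s ⟧ (≡-sym (++-assoc ws z _)) py) , x , px)

  Normal-⊙ˡ : ∀ {r s y} → Normal (r ⊙ s) → L⟦ s ⟧ y → Normal r
  Normal-⊙ˡ {r} nm py px = InfixClosure-infix {L = K n} ([] , _ , refl) (nm (_ , _ , px , py , refl))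

  Normal-⊙ʳ : ∀ {r s x} → Normal (r ⊙ s) → L⟦ r ⟧ x → Normal s
  Normal-⊙ʳ {r} {s} {x} nm px {y} py =
    InfixClosure-infix {L = K n} (x , [] , cong (x ++_) (≡-sym (++-identityʳ y))) (nm (_ , _ , px , py , refl))

  -- The induction on the number of vertices.

  module _ (N : ℕ) (1≤N : 1 ≤ N) where

    -- One exponent `N` serves all levels: it bounds the size of the given expression, and neither
    -- passing to a subexpression nor replacing a star by `εᵣ` increases the size.
    cycle : ∀ {k} → (Fin (suc k) → V) → List V
    -- Three loops at the only vertex, the fewest that satisfy `Long`.
    cycle {zero}  S = replicate 4 (S zero)
    cycle {suc k} S = concat (tabulate λ p → pow N (cycle (S ∘ punchIn p)))

    ∈-cycle⁻ : ∀ {k v} (S : Fin (suc k) → V) → v ∈ cycle S → ∃[ q ] v ≡ S q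
    ∈-cycle⁻ {zero} S (here eq) = zero , eq
    ∈-cycle⁻ {zero} S (there (here eq)) = zero , eq
    ∈-cycle⁻ {zero} S (there (there (here eq))) = zero , eq
    ∈-cycle⁻ {zero} S (there (there (there (here eq)))) = zero , eq
    ∈-cycle⁻ {suc k} S i with ∈-concat⁻′ (tabulate λ p → pow N (cycle (S ∘ punchIn p))) i
    ... | xs , j , xs∈ with ∈-tabulate⁻ {f = λ p → pow N (cycle (S ∘ punchIn p))} xs∈
    ...   | p , refl with ∈-cycle⁻ (S ∘ punchIn p) (∈-pow⁻ N j)
    ...     | q , eq = punchIn p q , eq

    Long-pow : ∀ {m w} → 1 ≤ m → Long w → Long (pow m w)
    Long-pow {suc m} _ lg = Long-++ lg

    Long-cycle : ∀ {k} (S : Fin (suc k) → V) → Long (cycle S)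
    Long-cycle {zero}  S = long
    Long-cycle {suc k} S = Long-++ (Long-pow 1≤N (Long-cycle (S ∘ punchIn zero)))

    module _ {k : ℕ} (S : Fin (suc (suc k)) → V) (S-injective : ∀ {p q} → S p ≡ S q → p ≡ q) where

      sub : Fin (suc (suc k)) → List V
      sub p = cycle (S ∘ punchIn p)

      -- If `s` encodes `S p`, that `p` is omitted. If `s` encodes no vertex of `S`, every choice
      -- works and `zero` is taken.
      avoiding : ∀ s → ∃[ p ] (∀ {v} → v ∈ pow N (sub p) → s ≢ e v)
      avoiding s with any? (λ p → ≡-dec _≟ₖ_ s (e (S p)))
      ... | no  ∄p       = zero , λ i eq → ∄p (_ , trans eq (cong e (proj₂ (∈-cycle⁻ (S ∘ punchIn zero) (∈-pow⁻ N i)))))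
      ... | yes (p , eq) = p , λ i eq′ → let q , v≡ = ∈-cycle⁻ (S ∘ punchIn p) (∈-pow⁻ N i) in
              punchInᵢ≢i p q (S-injective (trans (≡-sym v≡) (enc-injective (trans (≡-sym eq′) eq))))

      module _ (IH : ∀ p r → sizeᵣ r ≤ N → Normal r → Covers r (code (sub p)) → 2 ^ suc k ≤ width r) where

        -- A descent to a suitable star, by recursion on the focus `r`, while `plug C r` stays the
        -- same expression. The exponent `sizeᵣ r` is a budget: `⊙` divides it between its factors,
        -- and it is still at least 1 at the leaves. The index `p` may change at every star.
        search : ∀ C r → sizeᵣ (plug C r) ≤ N → Normal (plug C r) →
                 (∀ p → Covers (plug C r) (code (pow N (sub p)))) →
                 Normal r → ∀ p → Covers r (code (pow (sizeᵣ r) (sub p))) →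
                 2 ^ suc (suc k) ≤ width (plug C r)
        search C ∅ᵣ _ _ _ _ p (_ , _ , ())
        -- At a leaf the budget is down to one copy, whose code already requires two letters.
        search C εᵣ _ _ _ _ p cov with () ← Covers-code⇒2≤width {εᵣ} (Long-pow {1} ≤-refl (Long-cycle (S ∘ punchIn p))) cov
        search C (sym a) _ _ _ _ p cov with s≤s () ← Covers-code⇒2≤width {sym a} (Long-pow {1} ≤-refl (Long-cycle (S ∘ punchIn p))) cov
        search C (r ⊕ s) sz nm all nmr p (u , v , inj₁ q) =
          search (C ⊕ˡ s) r sz nm all (λ z → nmr (inj₁ z)) p
            (Covers-code {r} (pow-infix {sizeᵣ r} {sizeᵣ (r ⊕ s)} {sub p} (≤-trans (m≤m+n _ _) (m≤m+n _ 1))) (u , v , q))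
        search C (r ⊕ s) sz nm all nmr p (u , v , inj₂ q) =
          search (C ⊕ʳ r) s sz nm all (λ z → nmr (inj₂ z)) p
            (Covers-code {s} (pow-infix {sizeᵣ s} {sizeᵣ (r ⊕ s)} {sub p} (≤-trans (m≤n+m _ (sizeᵣ r)) (m≤m+n _ 1))) (u , v , q))
        search C (r ⊙ s) sz nm all nmr p cov
            with Covers-⊙ {r} {s} {sizeᵣ r} {sizeᵣ s} {sub p} (Covers-code {r ⊙ s} (pow-infix {sizeᵣ r + sizeᵣ s} {sizeᵣ (r ⊙ s)} {sub p} (m≤m+n _ 1)) cov)
        ... | inj₁ (cov′ , y , py) = search (C ⊙ˡ s) r sz nm all (Normal-⊙ˡ {r} {s} nmr py) p cov′
        ... | inj₂ (cov′ , x , px) = search (C ⊙ʳ r) s sz nm all (Normal-⊙ʳ {r} {s} nmr px) p cov′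
        search C (t ⋆) sz nm all nmr p cov@(u , v , q) = result
          where
          y : List ΣK
          y = u ++ code (pow (sizeᵣ (t ⋆)) (sub p)) ++ v

          lg : Long (pow (sizeᵣ (t ⋆)) (sub p))
          lg = Long-pow (1≤sizeᵣ (t ⋆)) (Long-cycle (S ∘ punchIn p))

          yExit : ∃[ s ] Exit y s
          yExit = code-∃-Exit lg (u , v , refl)

          yEntry : ∃[ s ] Entry y s
          yEntry = code-∃-Entry lg (u , v , refl)

          s : List ΣK
          s = proj₁ yExit

          -- A star may repeat `y`, so the exit of one copy meets the entry of the next.
          same : s ≡ proj₁ yEntry
          same = Exit-Entry-agree (proj₂ yExit) (proj₂ yEntry) (nmr (*-++ q q))

          -- Omitting the vertex of `s`, if it is in `S` at all, leaves no place in `m` where `y`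
          -- could be inserted.
          p′ : Fin (suc (suc k))
          p′ = proj₁ (avoiding s)

          sizes : sizeᵣ (t ⋆) ≤ N
          sizes = ≤-trans (sizeᵣ≤sizeᵣ-plug C (t ⋆)) sz

          -- The first half of the bound comes from the index `p` at which the star was reached; the
          -- second half will come from `p′`.
          width-t : 2 ^ suc k ≤ width t
          width-t = IH p (t ⋆) sizes nmr (Covers-code {t ⋆} (self-infix-pow (1≤sizeᵣ (t ⋆))) cov)

          open Replaces

          R : Replaces t (plug C (t ⋆)) (plug C εᵣ)
          R = Replaces-plug t C (Replaces-□ t)

          m : List ΣK
          m = code (pow N (sub p′))

          result : 2 ^ suc (suc k) ≤ width (plug C (t ⋆))
          result with all p′
          ... | α , β , w with trace R α m β w
          -- Inserting `y` at the cut would give a factor of a word of `K n`, so the code `m` would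
          -- have to visit the vertex of `s`, which it avoids.
          ...   | inj₁ (cut {m₁} {m₂} eq ins) with
                  cut-visits (Long-pow 1≤N (Long-cycle (S ∘ punchIn p′))) eq (proj₂ yExit)
                    (subst (Entry y) (≡-sym same) (proj₂ yEntry))
                    (InfixClosure-infix {L = K n} (α , m₂ ++ β , regroup₁ α m₁ y (m₂ ++ β)) (nm (ins q)))
                    (InfixClosure-infix {L = K n} (α ++ m₁ , β , cong ((α ++ m₁) ++_) (≡-sym (++-assoc y m₂ β))) (nm (ins q)))
            where
            regroup₁ : ∀ (α m₁ y z : List ΣK) → (α ++ m₁) ++ y ++ z ≡ α ++ (m₁ ++ y) ++ z
            regroup₁ α m₁ y z = solve (++-monoid ΣK)
          ...     | v′ , v∈ , s≡ = ⊥-elim (proj₂ (avoiding s) v∈ s≡)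
          -- The expression `t` alone covers a full `N`-th power, so the budget is restored and the
          -- descent goes on inside `t` with `p′`.
          result | α , β , w | inj₂ (inj₁ (_ , _ , covt)) =
            search (C ⋆) t sz nm all (λ z → nmr (*-embed z)) p′
              (Covers-code {t} (pow-infix (≤-trans (m≤m+n _ 1) sizes)) covt)
          -- The occurrence survives the removal of `t ⋆`, so the induction hypothesis applies to
          -- what remains.
          result | α , β , w | inj₂ (inj₂ (kept {α′} {β′} w′ _ _)) = begin
            2 ^ suc k + (2 ^ suc k + 0)          ≡⟨ cong (2 ^ suc k +_) (+-identityʳ (2 ^ suc k)) ⟩
            2 ^ suc k + 2 ^ suc k                ≤⟨ +-mono-≤ width-t rest ⟩
            width t + width (plug C εᵣ)          ≡⟨ width-plug C {t ⋆} {εᵣ} (≡-sym (+-identityʳ (width t))) ⟨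
            width (plug C (t ⋆))                 ∎
            where
            open ≤-Reasoning
            rest : 2 ^ suc k ≤ width (plug C εᵣ)
            rest = IH p′ (plug C εᵣ) (≤-trans (sizeᵣ-plug C (1≤sizeᵣ (t ⋆))) sz) (λ z → nm (sound R z))
                     (Covers-code {plug C εᵣ} (self-infix-pow 1≤N) (α′ , β′ , w′))

    cycle-width : ∀ {k} (S : Fin (suc k) → V) → (∀ {p q} → S p ≡ S q → p ≡ q) →
                  ∀ r → sizeᵣ r ≤ N → Normal r → Covers r (code (cycle S)) → 2 ^ suc k ≤ width r
    cycle-width {zero}  S inj r sz nm cov = Covers-code⇒2≤width {r} (Long-cycle S) cov
    cycle-width {suc k} S inj r sz nm cov =
      search S inj (λ p → cycle-width (S ∘ punchIn p) (λ eq → punchIn-injective p _ _ (inj eq)))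
        □ r sz nm all nm zero (Covers-code {r} (pow-infix sz) (all zero))
      where
      f : Fin (suc (suc k)) → List V
      f p = cycle (S ∘ punchIn p)
      all : ∀ p → Covers r (code (pow N (f p)))
      all p = Covers-code {r} (∈-infix-concat {xs = pow N (f p)} {tabulate (pow N ∘ f)} (∈-tabulate⁺ {f = pow N ∘ f} p)) cov

-- The exponent is chosen after `r`, as `sizeᵣ r`, and `S` enumerates all `n` vertices. The covered
-- word may be as long as needed, since `K n` contains the code of every walk with at least one
-- edge.
regexp-lower-bound : ∀ n → 2 ≤ n → (r : RegExp ΣK) → L⟦ r ⟧ ≐ K n → 2 ^ n ≤ sizeᵣ r
regexp-lower-bound (suc zero)    (s≤s ())
regexp-lower-bound n@(suc (suc _)) _ r (L⊆K , K⊆L) =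
  ≤-trans (cycle-width n (sizeᵣ r) (1≤sizeᵣ r) id id r ≤-refl
             (λ {w} p → [] , [] , subst (K n) (≡-sym (++-identityʳ w)) (L⊆K p))
             ([] , [] , subst L⟦ r ⟧ (≡-sym (++-identityʳ _)) (K⊆L (Long⇒K (Long-cycle n (sizeᵣ r) (1≤sizeᵣ r) id)))))
          (width≤sizeᵣ r)
  where
  Long⇒K : ∀ {vs} → Long n vs → K n (code n vs)
  Long⇒K (long {i} {j} {k} {l} {vs}) = code⇒K n i j (k ∷ l ∷ vs)

-- Automata given by a total transition function.

length-cartesianProduct : {A B : Set} (xs : List A) (ys : List B) → length (cartesianProduct xs ys) ≡ length xs * length ys
length-cartesianProduct []       ys = refl
length-cartesianProduct (x ∷ xs) ys =
  trans (length-++ (map (x ,_) ys)) (cong₂ _+_ (length-map (x ,_) ys) (length-cartesianProduct xs ys))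

take-drop-suc : {A : Set} (l : ℕ) (xs : List A) → l < length xs →
                ∃[ c ] (drop l xs ≡ c ∷ drop (suc l) xs × take (suc l) xs ≡ take l xs ++ [ c ])
take-drop-suc zero    (x ∷ xs) _ = x , refl , refl
take-drop-suc (suc l) (x ∷ xs) (s≤s lt) with take-drop-suc l xs lt
... | c , eq , eq′ = c , eq , cong (x ∷_) eq′

module _ {a b c d : ℕ} where

  combine₄ : Fin a × Fin b × Fin c × Fin d → Fin (a * (b * (c * d)))
  combine₄ (i , j , k , l) = combine i (combine j (combine k l))

  remQuot₄ : Fin (a * (b * (c * d))) → Fin a × Fin b × Fin c × Fin d
  remQuot₄ x = map₂ (λ y → map₂ (remQuot d) (remQuot (c * d) y)) (remQuot {a} (b * (c * d)) x)

  remQuot₄-combine₄ : ∀ t → remQuot₄ (combine₄ t) ≡ t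
  remQuot₄-combine₄ (i , j , k , l) =
    trans (cong (map₂ λ y → map₂ (remQuot d) (remQuot (c * d) y)) (remQuot-combine i (combine j (combine k l))))
      (cong (i ,_) (trans (cong (map₂ (remQuot d)) (remQuot-combine j (combine k l)))
        (cong (j ,_) (remQuot-combine k l))))

-- States are numbered by `to`; a left inverse is enough, since a run from the initial state meets
-- only numbers of the form `to x`.
module TotalAutomaton
  {A X : Set} (letters : List A) (letters-unique : Unique letters) (∈-letters : ∀ a → a ∈ letters)
  {size : ℕ} (to : X → Fin size) (from : Fin size → X) (from-to : ∀ x → from (to x) ≡ x)
  (next : X → A → X) (start : X) (accept : X → Bool)
  where

  next′ : Fin size → A → Fin size
  next′ q a = to (next (from q) a)

  transition : Fin size × A → Fin size × A × Fin size
  transition (q , a) = q , a , next′ q a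

  inputs : List (Fin size × A)
  inputs = cartesianProduct (allFin size) letters

  automaton : NFA A
  automaton = record
    { ∣Q∣      = size
    ; q₀       = to start
    ; δ        = map transition inputs
    ; δ-unique = map⁺ (cong λ { (q , a , _) → q , a }) (cartesianProduct⁺ (allFin⁺ size) letters-unique)
    ; F        = tabulateᵥ λ q → accept (from q)
    }

  open NFA automaton hiding (size)

  ∈δ⁻ : ∀ {q a q′} → (q , a , q′) ∈ δ → q′ ≡ next′ q a
  ∈δ⁻ i with ∈-map⁻ transition i
  ... | _ , _ , refl = refl

  ∈δ⁺ : ∀ q a → (q , a , next′ q a) ∈ δ
  ∈δ⁺ q a = ∈-map⁺ transition (∈-cartesianProduct⁺ (∈-allFin q) (∈-letters a))

  deterministic : Deterministic
  deterministic i j = trans (∈δ⁻ i) (≡-sym (∈δ⁻ j))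

  automaton-size : NFA.size automaton ≡ size + size * length letters
  automaton-size = cong (size +_) (trans (length-map transition inputs)
    (trans (length-cartesianProduct (allFin size) letters) (cong (λ k → k * length letters) (length-tabulate {n = size} (λ i → i)))))

  Run⁻ : ∀ {q w q′} → Run q w q′ → from q′ ≡ foldl next (from q) w
  Run⁻ done = refl
  Run⁻ {q} {a ∷ w} (step i run) with ∈δ⁻ i
  ... | refl = trans (Run⁻ run) (cong (λ x → foldl next x w) (from-to _))

  Run⁺ : ∀ q w → Run q w (foldl next′ q w)
  Run⁺ q []      = done
  Run⁺ q (a ∷ w) = step (∈δ⁺ q a) (Run⁺ (next′ q a) w)

  L⁻ : ∀ {w} → L w → accept (foldl next start w) ≡ true
  L⁻ {w} (q , q∈F , run) = trans (cong accept (≡-sym (trans (Run⁻ run) (cong (λ x → foldl next x w) (from-to start)))))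
    (trans (≡-sym (lookup∘tabulate _ q)) ([]=⇒lookup q∈F))

  L⁺ : ∀ {w} → accept (foldl next start w) ≡ true → L w
  L⁺ {w} acc = _ , lookup⇒[]= _ _ (trans (lookup∘tabulate _ (foldl next′ (to start) w)) (trans (cong accept
    (trans (Run⁻ (Run⁺ (to start) w)) (cong (λ x → foldl next x w) (from-to start)))) acc)) , Run⁺ (to start) w

-- The automaton reading block by block.

length-bits : ∀ b m → length (bits b m) ≡ b
length-bits zero    m = refl
length-bits (suc b) m = trans (length-++ (bits b (m / 2))) (trans (+-comm _ 1) (cong suc (length-bits b (m / 2))))

module BlockAutomaton (n : ℕ) (v₀ : Fin n) where

  V : Set
  V = Fin n

  b : ℕ
  b = ⌈log₂ n ⌉

  -- The index of the final letter of a block, which has `2 * b + 2` letters.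
  last : ℕ
  last = b + suc b

  length-block : ∀ i j → length (block n i j) ≡ suc last
  length-block i j = trans (length-++ (enc n j)) (trans (cong₂ (λ x y → x + suc y) (length-bits b (toℕ j))
    (trans (length-++ (enc n i)) (cong (_+ 1) (length-bits b (toℕ i))))) (arith b))
    where
    arith : ∀ b → b + suc (b + 1) ≡ suc (b + suc b)
    arith = solve-∀

  block-injective : ∀ {i j i′ j′} → block n i j ≡ block n i′ j′ → j ≡ j′
  block-injective {j = j} {j′ = j′} eq = enc-injective n (proj₁ (first-unique ($∉enc n j) ($∉enc n j′) eq))

  -- `just (f , p , q , l)`: the last `l` letters read are the first `l` letters of
  -- `block p q`; `f` tells whether an earlier block prescribes `p`. If not, only
  -- this prefix of `block p q` matters, and `p` and `q` are otherwise arbitrary.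
  -- `nothing` is a sink.
  State : Set
  State = Maybe (Fin 2 × V × V × Fin (suc last))

  Allowed : Fin 2 → V → V → Set
  Allowed zero    p p′ = ⊤
  Allowed (suc _) p p′ = p′ ≡ p

  allowed? : ∀ f p p′ → Dec (Allowed f p p′)
  allowed? zero    p p′ = yes tt
  allowed? (suc _) p p′ = p′ ≟F p

  -- The representative may change with every letter: any allowed block that agrees with the prefix
  -- and continues with `c` will do. Thus a single pair stands for a whole set of candidates.
  Extension : Fin 2 → V → V → ℕ → ΣK → Set
  Extension f p q l c = ∃[ p′ ] ∃[ q′ ] (Allowed f p p′ × take (suc l) (block n p′ q′) ≡ take l (block n p q) ++ [ c ])

  extension? : ∀ f p q l c → Dec (Extension f p q l c)
  extension? f p q l c = any? λ p′ → any? λ q′ → allowed? f p p′ ×-dec ≡-dec _≟ₖ_ _ _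

  advance : Fin 2 → V → V → Fin (suc last) → State
  advance f p q l with suc (toℕ l) <? suc last
  ... | yes lt = just (f , p , q , fromℕ< lt)
  -- The target of the completed block is the prescribed source of the next one. The second `q` is a
  -- placeholder for a target not yet read.
  ... | no  _  = just (suc zero , q , q , zero)

  next : State → ΣK → State
  next nothing              c = nothing
  next (just (f , p , q , l)) c with extension? f p q (toℕ l) c
  ... | yes (p′ , q′ , _) = advance f p′ q′ l
  ... | no  _             = nothing

  start : State
  start = just (zero , v₀ , v₀ , zero)

  -- The flag excludes the empty word, which is not in `K n`.
  accept : State → Bool
  accept (just (suc zero , _ , _ , zero)) = true
  accept _                                = false

  PathTo : Fin 2 → V → List ΣK → Set
  PathTo zero    p w = w ≡ []
  PathTo (suc _) p w = ∃[ i ] ∃[ us ] w ≡ code n (i ∷ us ++ [ p ])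

  code-∷ʳ : ∀ us p q → code n ((us ++ [ p ]) ++ [ q ]) ≡ code n (us ++ [ p ]) ++ block n p q
  code-∷ʳ []           p q = ++-identityʳ _
  code-∷ʳ (i ∷ [])     p q = trans (cong (block n i p ++_) (++-identityʳ _)) (cong (_++ block n p q) (≡-sym (++-identityʳ (block n i p))))
  code-∷ʳ (i ∷ j ∷ us) p q = trans (cong (block n i j ++_) (code-∷ʳ (j ∷ us) p q)) (≡-sym (++-assoc (block n i j) _ (block n p q)))

  PathTo-block : ∀ f {p q w} → PathTo f p w → PathTo (suc zero) q (w ++ block n p q)
  PathTo-block zero    {p} {q} refl             = p , [] , ≡-sym (++-identityʳ _)
  PathTo-block (suc _) {p} {q} (i , us , refl)  = i , us ++ [ p ] , ≡-sym (code-∷ʳ (i ∷ us) p q)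

  PathTo-allowed : ∀ f {p p′ w} → Allowed f p p′ → PathTo f p w → PathTo f p′ w
  PathTo-allowed zero    _    path = path
  PathTo-allowed (suc _) refl path = path

  -- The invariant for soundness. The sink accepts nothing, so nothing is claimed about it.
  Describes : State → List ΣK → Set
  Describes nothing                w = ⊤
  Describes (just (f , p , q , l)) w = ∃[ u ] (PathTo f p u × w ≡ u ++ take (toℕ l) (block n p q))

  advance-describes : ∀ f p q l {u} → PathTo f p u → Describes (advance f p q l) (u ++ take (suc (toℕ l)) (block n p q))
  advance-describes f p q l {u} path with suc (toℕ l) <? suc last
  ... | yes lt = u , path , cong (λ k → u ++ take k (block n p q)) (≡-sym (toℕ-fromℕ< lt))
  ... | no ≮   = u ++ block n p q , PathTo-block f path ,
                 trans (cong (u ++_) (take-all _ _ (≤-trans (≤-reflexive (length-block p q)) (≮⇒≥ ≮)))) (≡-sym (++-identityʳ _))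

  next-describes : ∀ st w c → Describes st w → Describes (next st c) (w ++ [ c ])
  next-describes nothing w c _ = tt
  next-describes (just (f , p , q , l)) w c (u , path , refl) with extension? f p q (toℕ l) c
  ... | no _ = tt
  ... | yes (p′ , q′ , al , eq) = subst (Describes (advance f p′ q′ l))
          (trans (cong (u ++_) eq) (≡-sym (++-assoc u _ [ c ])))
          (advance-describes f p′ q′ l (PathTo-allowed f al path))

  run-describes : ∀ st u w → Describes st u → Describes (foldl next st w) (u ++ w)
  run-describes st u []      d = subst (Describes st) (≡-sym (++-identityʳ u)) d
  run-describes st u (c ∷ w) d = subst (Describes (foldl next (next st c) w)) (++-assoc u [ c ] w)
    (run-describes (next st c) (u ++ [ c ]) w (next-describes st u c d))

  accept-describes : ∀ st w → accept st ≡ true → Describes st w → K n w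
  accept-describes (just (suc zero , p , q , zero)) _ _ (_ , (i , [] , refl) , refl) =
    subst (K n) (≡-sym (++-identityʳ _)) (code⇒K n i p [])
  accept-describes (just (suc zero , p , q , zero)) _ _ (_ , (i , j ∷ us , refl) , refl) =
    subst (K n) (≡-sym (++-identityʳ _)) (code⇒K n i j (us ++ [ p ]))

  sound : ∀ {w} → accept (foldl next start w) ≡ true → K n w
  sound {w} acc = accept-describes (foldl next start w) w acc (run-describes start [] w ([] , refl , refl))

  Allowed-trans : ∀ f {p p′ p₀} → Allowed f p p′ → Allowed f p p₀ → Allowed f p′ p₀
  Allowed-trans zero    _    _    = tt
  Allowed-trans (suc _) refl refl = refl

  advance-inner : ∀ f p q l (lt : suc (toℕ l) < suc last) → advance f p q l ≡ just (f , p , q , fromℕ< lt)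
  advance-inner f p q l lt with suc (toℕ l) <? suc last
  ... | yes _  = refl
  ... | no ≮   = ⊥-elim (≮ lt)

  advance-last : ∀ f p q l → suc (toℕ l) ≡ suc last → advance f p q l ≡ just (suc zero , q , q , zero)
  advance-last f p q l eq with suc (toℕ l) <? suc last
  ... | yes lt = ⊥-elim (<-irrefl eq lt)
  ... | no _   = refl

  -- The block actually being read is itself a candidate, so the search for an extension succeeds.
  -- It may return another pair, but one with the same prefix.
  next-block : ∀ f p q l c p₀ q₀ → Allowed f p p₀ →
               take (toℕ l) (block n p q) ≡ take (toℕ l) (block n p₀ q₀) →
               take (suc (toℕ l)) (block n p₀ q₀) ≡ take (toℕ l) (block n p₀ q₀) ++ [ c ] →
               ∃[ p′ ] ∃[ q′ ] (next (just (f , p , q , l)) c ≡ advance f p′ q′ l × Allowed f p′ p₀ ×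
                 take (suc (toℕ l)) (block n p′ q′) ≡ take (suc (toℕ l)) (block n p₀ q₀))
  next-block f p q l c p₀ q₀ al eq take≡ with extension? f p q (toℕ l) c
  ... | no ∄ = ⊥-elim (∄ (p₀ , q₀ , al , trans take≡ (cong (_++ [ c ]) (≡-sym eq))))
  ... | yes (p′ , q′ , al′ , eq′) = p′ , q′ , refl , Allowed-trans f al′ al ,
        trans eq′ (trans (cong (_++ [ c ]) eq) (≡-sym take≡))

  -- Induction on `d`, where `d + 1` letters of the block are still to be read. After the last one
  -- the prefix is the entire block, so the representative has the true target.
  run-block : ∀ d f p q l p₀ q₀ → toℕ l + d ≡ last → Allowed f p p₀ →
              take (toℕ l) (block n p q) ≡ take (toℕ l) (block n p₀ q₀) →
              foldl next (just (f , p , q , l)) (drop (toℕ l) (block n p₀ q₀)) ≡ just (suc zero , q₀ , q₀ , zero)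
  run-block d f p q l p₀ q₀ len al eq
      with take-drop-suc (toℕ l) (block n p₀ q₀) (subst (toℕ l <_) (≡-sym (length-block p₀ q₀)) (toℕ<n l))
  ... | c , drop≡ , take≡ with next-block f p q l c p₀ q₀ al eq take≡
  run-block zero f p q l p₀ q₀ len al eq | c , drop≡ , take≡ | p′ , q′ , next≡ , al′ , eq′
      = trans (cong (foldl next (just (f , p , q , l))) (trans drop≡ (cong (c ∷_) (drop-all (suc (toℕ l)) (block n p₀ q₀) (full p₀ q₀)))))
          (trans next≡ (trans (advance-last f p′ q′ l l≡last) (cong (λ v → just (suc zero , v , v , zero)) q′≡q₀)))
    where
    l≡last : suc (toℕ l) ≡ suc last
    l≡last = cong suc (trans (≡-sym (+-identityʳ (toℕ l))) len)
    full : ∀ i j → length (block n i j) ≤ suc (toℕ l)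
    full i j = ≤-reflexive (trans (length-block i j) (≡-sym l≡last))
    q′≡q₀ : q′ ≡ q₀
    q′≡q₀ = block-injective (trans (≡-sym (take-all _ _ (full p′ q′))) (trans eq′ (take-all _ _ (full p₀ q₀))))
  run-block (suc d) f p q l p₀ q₀ len al eq | c , drop≡ , take≡ | p′ , q′ , next≡ , al′ , eq′
      = trans (cong (foldl next (just (f , p , q , l))) drop≡)
          (trans (cong (λ st → foldl next st rest) (trans next≡ (advance-inner f p′ q′ l lt)))
            (subst (λ k → foldl next (just (f , p′ , q′ , l′)) (drop k (block n p₀ q₀)) ≡ just (suc zero , q₀ , q₀ , zero)) l′≡
              (run-block d f p′ q′ l′ p₀ q₀ (trans (cong (_+ d) l′≡) len′) al′
                (subst (λ k → take k (block n p′ q′) ≡ take k (block n p₀ q₀)) (≡-sym l′≡) eq′))))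
    where
    rest : List ΣK
    rest = drop (suc (toℕ l)) (block n p₀ q₀)
    len′ : suc (toℕ l) + d ≡ last
    len′ = trans (≡-sym (+-suc (toℕ l) d)) len
    lt : suc (toℕ l) < suc last
    lt = s≤s (subst (suc (toℕ l) ≤_) len′ (m≤m+n (suc (toℕ l)) d))
    l′ : Fin (suc last)
    l′ = fromℕ< lt
    l′≡ : toℕ l′ ≡ suc (toℕ l)
    l′≡ = toℕ-fromℕ< lt

  complete : ∀ f p q i j vs → Allowed f p i → ∃[ v ] foldl next (just (f , p , q , zero)) (code n (i ∷ j ∷ vs)) ≡ just (suc zero , v , v , zero)
  complete f p q i j [] al = j , trans (cong (foldl next _) (++-identityʳ (block n i j))) (run-block last f p q zero i j refl al refl)
  complete f p q i j (k ∷ vs) al with complete (suc zero) j j j k vs refl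
  ... | v , eq = v , trans (foldl-++ next _ (block n i j) (code n (j ∷ k ∷ vs)))
                       (trans (cong (λ st → foldl next st (code n (j ∷ k ∷ vs))) (run-block last f p q zero i j refl al refl)) eq)

  accepts : ∀ {w} → K n w → accept (foldl next start w) ≡ true
  accepts k with K⇒code n k
  ... | i , j , vs , refl = cong accept (proj₂ (complete zero v₀ v₀ i j vs tt))

  states : ℕ
  states = suc (2 * (n * (n * suc last)))

  to : State → Fin states
  to nothing                  = zero
  to (just (f , p , q , l)) = suc (combine₄ (f , p , q , l))

  from : Fin states → State
  from zero    = nothing
  from (suc x) = just (remQuot₄ x)

  from-to : ∀ st → from (to st) ≡ st
  from-to nothing                  = refl
  from-to (just (f , p , q , l)) = cong just (remQuot₄-combine₄ (f , p , q , l))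

  letters : List ΣK
  letters = 𝟘 ∷ 𝟙 ∷ $ ∷ ♯ ∷ []

  letters-unique : Unique letters
  letters-unique = ((λ ()) ∷ (λ ()) ∷ (λ ()) ∷ []) ∷ ((λ ()) ∷ (λ ()) ∷ []) ∷ ((λ ()) ∷ []) ∷ [] ∷ []

  ∈-letters : ∀ a → a ∈ letters
  ∈-letters 𝟘 = here refl
  ∈-letters 𝟙 = there (here refl)
  ∈-letters $ = there (there (here refl))
  ∈-letters ♯ = there (there (there (here refl)))

  open TotalAutomaton letters letters-unique ∈-letters to from from-to next start accept public
    using (automaton; deterministic; automaton-size; L⁻; L⁺)

  automaton-defines : NFA.L automaton ≐ K n
  automaton-defines = (λ p → sound (L⁻ p)) , λ k → L⁺ (accepts k)

  -- With four transitions per state the size is five times `1 + 4 * n ^ 2 * (1 + b)`. As `b` and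
  -- `n ^ 2 * b` are at least 1, the two summands are at most 5 and 40 times `n ^ 2 * b`.
  size-bound : 2 ≤ n → NFA.size automaton ≤ 45 * (n ^ 2 * b)
  size-bound 2≤n = begin
    NFA.size automaton                                  ≡⟨ automaton-size ⟩
    states + states * 4                                 ≡⟨ expand n b ⟩
    5 + 20 * (n ^ 2 * (1 + b))                          ≤⟨ +-mono-≤ (*-monoʳ-≤ 5 1≤n²b) (*-monoʳ-≤ 20 (*-monoʳ-≤ (n ^ 2) (+-mono-≤ 1≤b (≤-refl {b})))) ⟩
    5 * (n ^ 2 * b) + 20 * (n ^ 2 * (b + b))            ≡⟨ collect (n ^ 2) b ⟩
    45 * (n ^ 2 * b)                                    ∎
    where
    open ≤-Reasoning
    1≤b : 1 ≤ b
    1≤b = ⌈log₂⌉-mono-≤ 2≤n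
    1≤n²b : 1 ≤ n ^ 2 * b
    1≤n²b = *-mono-≤ (m^n>0 n {{>-nonZero (≤-trans (s≤s z≤n) 2≤n)}} 2) 1≤b
    expand : ∀ n b → (1 + 2 * (n * (n * (1 + (b + (1 + b)))))) + (1 + 2 * (n * (n * (1 + (b + (1 + b)))))) * 4 ≡
                     5 + 20 * (n * (n * 1) * (1 + b))
    expand = solve-∀
    collect : ∀ m b → 5 * (m * b) + 20 * (m * (b + b)) ≡ 45 * (m * b)
    collect = solve-∀

theorem3p4 : Σ[ c ∈ ℕ ] ((n : ℕ) → 2 ≤ n →
    ((r : RegExp ΣK) → L⟦ r ⟧ ≐ K n → 2 ^ n ≤ sizeᵣ r)
    × (Σ[ A ∈ NFA ΣK ] (NFA.Deterministic A × NFA.L A ≐ K n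
    × NFA.size A ≤ c * (n ^ 2 * ⌈log₂ n ⌉))))
theorem3p4 = 45 , λ n 2≤n → regexp-lower-bound n 2≤n , upper n 2≤n
  where
  upper : ∀ n → 2 ≤ n → Σ[ A ∈ NFA ΣK ] (NFA.Deterministic A × NFA.L A ≐ K n × NFA.size A ≤ 45 * (n ^ 2 * ⌈log₂ n ⌉))
  upper n@(suc _) 2≤n = automaton , (λ {q} → deterministic {q}) , automaton-defines , size-bound 2≤n
    where open BlockAutomaton n zero
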